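{- For every integer $t$ there exists an integer $k\le 16\,\ell(t-1)+1$ such that the following holds. If $G$ is a graph with no $K_t$ minor and $T$ is a spanning forest of $G$, then there exists a coloring $\phi:E(G)\setminus E(T)\to\{1,\dots,k\}$ such that for every edge $f\in E(T)$ that is not a bridge of $G$, there exists a color $i\in\{1,\dots,k\}$ which occurs an odd number of times on the fundamental cut of $T$ with respect to $f$.
   Context: The star-arboricity of a graph is the minimum number of star forests (forests each of whose components has diameter at most 2) into which its edge set can be decomposed. For an integer $s$, $\ell(s)$ denotes the largest star-arboricity of any graph with no $K_s$ minor. A spanning forest of $G$ is a maximal acyclic subgraph of $G$. For a spanning forest $T$ of $G$ and $f\in E(T)$, deleting $f$ from $T$ splits the component of $T$ containing $f$ into two components; the fundamental cut of $T$ with respect to $f$ is the set of all edges of $G$ joining the vertex sets of these two components (it contains $f$). "Occurs on the fundamental cut" refers to edges of the cut lying in $E(G)\setminus E(T)$, the domain of $\phi$. -}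

module Defs where

open import Level using (0ℓ)
open import Data.Bool using (Bool; false; T; not; _∧_)
open import Data.Bool.Properties using (T-∧)
open import Data.Empty using (⊥-elim)
open import Data.Fin using (Fin; _<_; _≟_)
open import Data.Fin.Subset using (Subset; _∈_; _∩_; Nonempty; Empty)
open import Data.List using (List; _∷_; [_]; length)
open import Data.List.Relation.Unary.Unique.Propositional using (Unique)
import Data.List.Membership.Propositional as List
open import Data.Nat using (ℕ; suc; _≤_)
open import Data.Nat.Divisibility using (_∣_)
open import Data.Product using (Σ; ∃; ∃!; _×_; _,_; proj₁; proj₂)
open import Data.Sum using (_⊎_)
open import Function.Bundles using (_⇔_; Equivalence)
open import Relation.Binary using (Rel)
open import Relation.Binary.Construct.Closure.ReflexiveTransitive using (Star; ε; _◅_)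
open import Relation.Binary.PropositionalEquality using (_≡_; _≢_; refl; sym; cong; cong₂)
open import Relation.Nullary using (¬_; does; yes; no)
open import Relation.Unary using (Pred)

private
  variable
    m n : ℕ

record Graph (n : ℕ) : Set where
  field
    adj    : Fin n → Fin n → Bool
    symm   : ∀ u v → adj u v ≡ adj v u
    irrefl : ∀ v → adj v v ≡ false

  Adj : Rel (Fin n) 0ℓ
  Adj u v = T (adj u v)

open Graph public

infix 4 _⊑_

-- Subgraphs with the same vertex set.
_⊑_ : Graph n → Graph n → Set
H ⊑ G = ∀ u v → Adj H u v → Adj G u v

-- The spanning subgraph with edge set E(G) ∖ E(H).
_∖_ : Graph n → Graph n → Graph n
G ∖ H = record
  { adj    = λ u v → adj G u v ∧ not (adj H u v)
  ; symm   = λ u v → cong₂ _∧_ (symm G u v) (cong not (symm H u v))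
  ; irrefl = λ v → cong (_∧ not (adj H v v)) (irrefl G v)
  }

-- Each undirected edge is represented once, by its ends in increasing order;
-- both proof fields are propositions, so edges are equal iff their ends are.
record Edge (G : Graph n) : Set where
  constructor edge
  field
    {end₁ end₂} : Fin n
    ordered     : end₁ < end₂
    adjacent    : Adj G end₁ end₂

open Edge public

∖-edge : (G H : Graph n) → Edge (G ∖ H) → Edge G
∖-edge G H (edge u<v uv) = edge u<v (proj₁ (Equivalence.to T-∧ uv))

len : {R : Rel (Fin n) 0ℓ} {u v : Fin n} → Star R u v → ℕ
len ε       = 0
len (_ ◅ p) = suc (len p)

vertices : {R : Rel (Fin n) 0ℓ} {u v : Fin n} → Star R u v → List (Fin n)
vertices {u = u} ε       = [ u ]
vertices {u = u} (_ ◅ p) = u ∷ vertices p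

-- Adjacency in G − e, where e is the edge with ends a and b.
deleteEdge : Graph n → Fin n → Fin n → Rel (Fin n) 0ℓ
deleteEdge G a b u v =
  Adj G u v × ¬ ((u ≡ a × v ≡ b) ⊎ (u ≡ b × v ≡ a))

Bridge : Graph n → Fin n → Fin n → Set
Bridge G a b = Adj G a b × ¬ Star (deleteEdge G a b) a b

-- A cycle is a path with at least two edges together with an edge joining
-- its ends.
Cycle : Graph n → Set
Cycle G = ∃ λ u → ∃ λ v → Σ (Star (Adj G) u v) λ p →
  Unique (vertices p) × 2 ≤ len p × Adj G v u

Acyclic : Graph n → Set
Acyclic G = ¬ Cycle G

record SpanningForest (G F : Graph n) : Set where
  field
    subgraph : F ⊑ G
    acyclic  : Acyclic F
    maximal  : ∀ H → F ⊑ H → H ⊑ G → Acyclic H → H ⊑ F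

-- The set of edges of G joining the two components into which deleting f
-- splits the component of F containing f.
FundamentalCut : (G F : Graph n) → Edge F → Pred (Edge G) 0ℓ
FundamentalCut G F f e =
  (side₁ (end₁ e) × side₂ (end₂ e)) ⊎ (side₁ (end₂ e) × side₂ (end₁ e))
  where
  side₁ side₂ : Pred (Fin _) 0ℓ
  side₁ = Star (deleteEdge F (end₁ f) (end₂ f)) (end₁ f)
  side₂ = Star (deleteEdge F (end₁ f) (end₂ f)) (end₂ f)

-- P is satisfied by an odd number of elements of A: some duplicate-free list
-- of odd length enumerates exactly those elements.
OddlyMany : {A : Set} → Pred A 0ℓ → Set
OddlyMany {A} P = Σ (List A) λ xs →
  Unique xs × (∀ x → x List.∈ xs ⇔ P x) × ¬ (2 ∣ length xs)

OccursOddly : ∀ {k} (G F : Graph n) → (Edge (G ∖ F) → Fin k) → Edge F → Fin k → Set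
OccursOddly G F φ f i =
  OddlyMany λ e → FundamentalCut G F f (∖-edge G F e) × φ e ≡ i

K : ∀ t → Graph t
K t = record
  { adj    = λ i j → not (does (i ≟ j))
  ; symm   = K-symm
  ; irrefl = K-irrefl
  }
  where
  K-symm : ∀ (i j : Fin t) → not (does (i ≟ j)) ≡ not (does (j ≟ i))
  K-symm i j with i ≟ j | j ≟ i
  ... | yes _   | yes _   = refl
  ... | no  _   | no  _   = refl
  ... | yes i≡j | no  j≢i = ⊥-elim (j≢i (sym i≡j))
  ... | no  i≢j | yes j≡i = ⊥-elim (i≢j (sym j≡i))

  K-irrefl : ∀ (i : Fin t) → not (does (i ≟ i)) ≡ false
  K-irrefl i with i ≟ i
  ... | yes _   = refl
  ... | no  i≢i = ⊥-elim (i≢i refl)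

induced : Graph n → Subset n → Rel (Fin n) 0ℓ
induced G B u v = u ∈ B × v ∈ B × Adj G u v

-- The branch sets contract to the vertices of H; surplus vertices and edges of G
-- are deleted.
record _IsMinorOf_ (H : Graph m) (G : Graph n) : Set where
  field
    branch    : Fin m → Subset n
    nonempty  : ∀ i → Nonempty (branch i)
    disjoint  : ∀ i j → i ≢ j → Empty (branch i ∩ branch j)
    connected : ∀ i u v → u ∈ branch i → v ∈ branch i →
                Star (induced G (branch i)) u v
    joined    : ∀ i j → Adj H i j →
                ∃ λ u → ∃ λ v → u ∈ branch i × v ∈ branch j × Adj G u v

-- Two vertices are at distance at most d iff some walk of length at most d
-- joins them.
ComponentDiameters≤ : ℕ → Graph n → Set
ComponentDiameters≤ d G = ∀ u v → Star (Adj G) u v →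
  Σ (Star (Adj G) u v) λ p → len p ≤ d

StarForest : Graph n → Set
StarForest G = Acyclic G × ComponentDiameters≤ 2 G

record StarDecomposition (G : Graph n) (m : ℕ) : Set where
  field
    part        : Fin m → Graph n
    part⊑       : ∀ i → part i ⊑ G
    starForest  : ∀ i → StarForest (part i)
    partitioned : ∀ u v → Adj G u v → ∃! _≡_ λ i → Adj (part i) u v

IsStarArboricity : Graph n → ℕ → Set
IsStarArboricity G m =
  StarDecomposition G m × (∀ m′ → StarDecomposition G m′ → m ≤ m′)

-- m is the star-arboricity of some graph with no K_s minor.
StarArboricityWithout-K : ℕ → ℕ → Set
StarArboricityWithout-K s m = ∃ λ n → Σ (Graph n) λ G →
  ¬ (K s IsMinorOf G) × IsStarArboricity G m

-- L = ℓ(s).  Every graph has a K_0 minor, so for s = 0 the maximum is over the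
-- empty set and is taken to be 0.
record Isℓ (s L : ℕ) : Set where
  field
    bound    : ∀ m → StarArboricityWithout-K s m → m ≤ L
    attained : StarArboricityWithout-K s L
             ⊎ ((∀ m → ¬ StarArboricityWithout-K s m) × L ≡ 0)

module Submission where

-- Eight is 2 · 4, and the factor 4 comes from undoing one growth step. The values on `e₁` and `e₂`
-- are tied by a single equation. Over one bit the only nonzero value on `e₁` may force 0 on `e₂`;
-- as soon as `e₁` has two nonzero values to choose from, one of them leaves `e₂` nonzero. Seymour's
-- choice is Z₃, which gives six values; here it is F₂², so that all three coordinates are Boolean
-- and obey the same lemmas. The remaining bit pays for `C`: it is nonzero there, so `f₂` and `f₃`
-- may be altered freely on `C` to restore conservation inside `U`. Flows are described by cuts
-- alone: the values sum to 0 over the edges crossing any vertex set. In this form identifying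
-- vertices means testing against fewer sets, and releasing them means restoring orthogonality to
-- more. Bridges are cuts with one edge, and the equation on a fundamental cut is one instance of
-- orthogonality.

-- Colouring by flows: for every spanning forest T the value of a flow over F₂³ on an edge f of T is
-- the sum of its values on the other edges of the fundamental cut of f.  If it is nonzero, some
-- value occurs an odd number of times among these edges.  By Jaeger's theorem there is such a flow
-- that vanishes only on bridges, so 8 colours suffice for every graph, and 8 ≤ 16 ℓ(t − 1) + 1 as soon
-- as ℓ(t − 1) ≥ 1, in particular for t ≥ 4, since K₂ has no K₃ minor.  For t ≤ 3 a graph without a
-- K_t minor has only bridges.
--
-- Jaeger's theorem is proved by Seymour's method.  Contracting an edge of each cut of size one or two
-- leaves a multigraph all of whose nonempty cuts have at least three edges.  There a set X grows from ∅
-- to the whole vertex set.  A minimal nonempty S outside X with at most one edge to the rest is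
-- 2-edge-connected and, unless no edge leaves it, has two edges e₁, e₂ to X.  A flow of value 2 inside S
-- between their ends (Menger) yields a connected even subgraph C containing both ends, and X absorbs C.
-- Undoing this step, C is added to f₁, and the values of (f₂ , f₃) on e₁ and e₂, which are tied only by
-- the cut around C, can both be chosen nonzero.

open import Defs
open import Data.Nat using (ℕ; _+_; _*_; _∸_; _≤_)
open import Data.Fin using (Fin)
open import Data.Product using (∃; Σ; _×_)
open import Relation.Nullary using (¬_)

open import Algebra.Bundles using (CommutativeMonoid; CommutativeRing)
import Algebra.Properties.CommutativeMonoid.Sum as Summation
import Algebra.Properties.CommutativeSemigroup as CommutativeSemigroup
open import Data.Bool using (Bool; true; false; T; not; _∧_; _∨_; _xor_; if_then_else_)
open import Data.Bool.Properties as Bool using (xor-∧-commutativeRing; T-≡)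
open import Data.Bool.Solver using (module xor-∧-Solver)
open import Data.Empty using (⊥)
open import Data.Fin as Fin using (zero; suc; _≟_; combine; remQuot)
open import Data.Fin.Patterns
open import Data.Fin.Properties as Fin using (any?; all?; suc-injective; remQuot-combine; combine-injective;
  combine-remQuot; pigeonhole; inject≤-injective)
open import Data.Fin.Subset.Properties using (anySubset?; x∈p∩q⁺; x∈p∩q⁻)
open import Data.Fin.Subset using () renaming (_∈_ to _∈ₛ_)
open import Data.Integer as ℤ using (ℤ; 0ℤ; 1ℤ; -1ℤ; +_)
import Data.Integer.Properties as ℤ
import Data.Integer.Solver as ℤ
open import Data.List using (List; []; _∷_; length; allFin) renaming (tabulate to tabulateᴸ)
open import Data.List.Membership.DecPropositional using (_∈?_)
open import Data.List.Membership.Propositional using (_∈_)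
open import Data.List.Membership.Propositional.Properties using (∈-allFin)
open import Data.List.Relation.Unary.All using ([]; _∷_)
open import Data.List.Relation.Unary.All.Properties using (¬Any⇒All¬; All¬⇒¬Any)
open import Data.List.Relation.Unary.AllPairs using ([]; _∷_)
open import Data.List.Relation.Unary.Any using (here; there)
open import Data.List.Relation.Unary.Unique.Propositional using (Unique)
open import Data.List.Relation.Unary.Unique.Propositional.Properties using (allFin⁺)
open import Data.Nat as ℕ using (zero; suc; _<_; z≤n; s≤s)
open import Data.Nat.Divisibility using (_∣_; divides)
import Data.Nat.Properties as ℕ
open import Data.Product using (∃₂; _,_; proj₁; proj₂)
open import Data.Sum using (_⊎_; inj₁; inj₂; [_,_]′)
open import Data.Unit using (tt)
open import Data.Vec using (lookup; tabulate)
open import Data.Vec.Properties using (lookup∘tabulate; lookup⇒[]=; []=⇒lookup)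
open import Function using (_∘_; id; flip)
open import Function.Bundles using (Equivalence; _⇔_; mk⇔)
open import Level using (0ℓ)
open import Relation.Binary using (Rel; Decidable; tri<; tri≈; tri>)
open import Relation.Binary.Construct.Closure.ReflexiveTransitive as Star using (Star; ε; _◅_; _◅◅_)
open import Relation.Binary.PropositionalEquality
open import Relation.Nullary using (Dec; yes; no; does; contradiction)
open import Relation.Nullary.Decidable as Dec using (dec-true; dec-false; map′; _×-dec_; _⊎-dec_; _→-dec_; ¬?; T?; toSum)
open import Relation.Unary using (Pred)

-- Boolean sets

Side : ℕ → Set
Side n = Fin n → Bool

infix 5 _==_
_==_ : ∀ {n} → Fin n → Fin n → Bool
i == j = does (i ≟ j)

==-refl : ∀ {n} (i : Fin n) → (i == i) ≡ true
==-refl i = dec-true (i ≟ i) refl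

==-≢ : ∀ {n} {i j : Fin n} → i ≢ j → (i == j) ≡ false
==-≢ {i = i} {j} i≢j = dec-false (i ≟ j) i≢j

does-sound : ∀ {a} {A : Set a} (A? : Dec A) → does A? ≡ true → A
does-sound (yes x) _ = x

==-sound : ∀ {n} {i j : Fin n} → (i == j) ≡ true → i ≡ j
==-sound {i = i} {j} = does-sound (i ≟ j)

true≢false : true ≢ false
true≢false ()

true∧ : ∀ {a b} → a ∧ b ≡ true → a ≡ true × b ≡ true
true∧ {true} eq = refl , eq

∧-true : ∀ {a b} → a ≡ true → b ≡ true → a ∧ b ≡ true
∧-true refl refl = refl

true∨ : ∀ {a b} → a ∨ b ≡ true → a ≡ true ⊎ b ≡ true
true∨ {true}  eq = inj₁ refl
true∨ {false} eq = inj₂ eq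

∨-trueˡ : ∀ {a} b → a ≡ true → a ∨ b ≡ true
∨-trueˡ b refl = refl

∨-trueʳ : ∀ a {b} → b ≡ true → a ∨ b ≡ true
∨-trueʳ true  refl = refl
∨-trueʳ false refl = refl

xor-true : ∀ {a b} → a xor b ≡ true → (a ≡ true × b ≡ false) ⊎ (a ≡ false × b ≡ true)
xor-true {true}  {false} eq = inj₁ (refl , refl)
xor-true {false} {true}  eq = inj₂ (refl , refl)

xor-false : ∀ {a b} → a xor b ≡ false → a ≡ b
xor-false {true}  {true}  eq = refl
xor-false {false} {false} eq = refl

xor-≡ : ∀ {a b} → a ≡ b → a xor b ≡ false
xor-≡ {a} refl = Bool.xor-same a

iff-≡ : ∀ {a b} → (a ≡ true → b ≡ true) → (b ≡ true → a ≡ true) → a ≡ b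
iff-≡ {true}  {b}     f g = sym (f refl)
iff-≡ {false} {true}  f g = g refl
iff-≡ {false} {false} f g = refl

not-true : ∀ {a} → not a ≡ true → a ≡ false
not-true {false} eq = refl

-- Finite sums

module _ {c ℓ} (M : CommutativeMonoid c ℓ) where
  open CommutativeMonoid M
    using (Carrier; _≈_; ∙-congˡ; ∙-cong; identityʳ; identityˡ; reflexive)
    renaming (ε to 0#; refl to ≈-refl; trans to ≈-trans)
  open Summation M

  sum-zero : ∀ {n} (f : Fin n → Carrier) → (∀ i → f i ≡ 0#) → sum f ≈ 0#
  sum-zero {zero}  f f≡0 = ≈-refl
  sum-zero {suc n} f f≡0 =
    ≈-trans (∙-cong (reflexive (f≡0 zero)) (sum-zero (f ∘ suc) (f≡0 ∘ suc))) (identityˡ 0#)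

  sum-point : ∀ {n} (f : Fin n → Carrier) j → (∀ i → i ≢ j → f i ≡ 0#) → sum f ≈ f j
  sum-point {suc n} f zero    f≡0 =
    ≈-trans (∙-congˡ (sum-zero (f ∘ suc) (λ i → f≡0 (suc i) λ ()))) (identityʳ _)
  sum-point {suc n} f (suc j) f≡0 =
    ≈-trans (∙-cong (reflexive (f≡0 zero λ ())) (sum-point (f ∘ suc) j λ i i≢j → f≡0 (suc i) (i≢j ∘ suc-injective)))
            (identityˡ _)

xor-commutativeMonoid : CommutativeMonoid _ _
xor-commutativeMonoid = CommutativeRing.+-commutativeMonoid xor-∧-commutativeRing

module ⊕ = Summation xor-commutativeMonoid
module Σℕ = Summation ℕ.+-0-commutativeMonoid
module Σℤ = Summation ℤ.+-0-commutativeMonoid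

⨁ : ∀ {m} → (Fin m → Bool) → Bool
⨁ = ⊕.sum

𝟙 : Bool → ℕ
𝟙 b = if b then 1 else 0

count : ∀ {m} → (Fin m → Bool) → ℕ
count p = Σℕ.sum (𝟙 ∘ p)

infixl 6 _−_
_−_ : ∀ {m} → (Fin m → Bool) → Fin m → Fin m → Bool
(p − i) j = p j ∧ not (j == i)

−-≢ : ∀ {m} (p : Fin m → Bool) {i j} → j ≢ i → (p − i) j ≡ p j
−-≢ p {i} {j} j≢i = trans (cong (λ b → p j ∧ not b) (==-≢ j≢i)) (Bool.∧-identityʳ (p j))

count-remove : ∀ {m} (p : Fin m → Bool) {i} → p i ≡ true → count p ≡ suc (count (p − i))
count-remove p {i} pi = begin
  count p                                            ≡⟨ Σℕ.sum-cong-≗ split ⟩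
  Σℕ.sum (λ j → 𝟙 (j == i) + 𝟙 ((p − i) j))          ≡⟨ Σℕ.∑-distrib-+ (𝟙 ∘ (_== i)) _ ⟩
  Σℕ.sum (λ j → 𝟙 (j == i)) + count (p − i)          ≡⟨ cong (_+ count (p − i)) (sum-point ℕ.+-0-commutativeMonoid _ i (λ j j≢i → cong 𝟙 (==-≢ j≢i))) ⟩
  𝟙 (i == i) + count (p − i)                         ≡⟨ cong (λ b → 𝟙 b + count (p − i)) (==-refl i) ⟩
  suc (count (p − i))                                ∎
  where
  open ≡-Reasoning
  split : ∀ j → 𝟙 (p j) ≡ 𝟙 (j == i) + 𝟙 ((p − i) j)
  split j with j ≟ i
  ... | yes refl rewrite pi = refl
  ... | no  _    = sym (cong 𝟙 (Bool.∧-identityʳ (p j)))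

count-none : ∀ {m} (p : Fin m → Bool) → (∀ i → p i ≡ false) → count p ≡ 0
count-none p none = sum-zero ℕ.+-0-commutativeMonoid _ λ i → cong 𝟙 (none i)

count≡0 : ∀ {m} (p : Fin m → Bool) → count p ≡ 0 → ∀ i → p i ≡ false
count≡0 p p≡0 i with p i in eq
... | false = refl
... | true  = contradiction (trans (sym p≡0) (count-remove p eq)) λ ()

count-some : ∀ {m} (p : Fin m → Bool) → 1 ≤ count p → ∃ λ i → p i ≡ true
count-some p 1≤p with any? (λ i → p i Bool.≟ true)
... | yes i   = i
... | no none = contradiction (subst (1 ≤_) (count-none p λ i → Bool.¬-not (none ∘ (i ,_))) 1≤p) λ ()

count-mono : ∀ {m} (p q : Fin m → Bool) → (∀ i → p i ≡ true → q i ≡ true) → count p ≤ count q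
count-mono {zero}  p q p⊆q = z≤n
count-mono {suc m} p q p⊆q = ℕ.+-mono-≤ (head (p zero) (q zero) (p⊆q zero)) (count-mono (p ∘ suc) (q ∘ suc) (p⊆q ∘ suc))
  where
  head : ∀ a b → (a ≡ true → b ≡ true) → 𝟙 a ≤ 𝟙 b
  head false b     a⊆b = z≤n
  head true  true  a⊆b = ℕ.≤-refl
  head true  false a⊆b = contradiction (sym (a⊆b refl)) true≢false

count-strict : ∀ {m} (p q : Fin m → Bool) → (∀ i → p i ≡ true → q i ≡ true) →
               ∀ i → q i ≡ true → p i ≡ false → count p < count q
count-strict p q p⊆q i qi ¬pi = subst (count p <_) (sym (count-remove q qi)) (s≤s (count-mono p (q − i) inside))
  where
  inside : ∀ j → p j ≡ true → (q − i) j ≡ true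
  inside j pj with j ≟ i
  ... | yes refl = contradiction (trans (sym pj) ¬pi) true≢false
  ... | no  _    = trans (Bool.∧-identityʳ (q j)) (p⊆q j pj)

count-two : ∀ {m} (p : Fin m → Bool) → 2 ≤ count p → ∃₂ λ i j → i ≢ j × p i ≡ true × p j ≡ true
count-two p 2≤p with i , pi ← count-some p (ℕ.≤-trans (s≤s z≤n) 2≤p)
                with j , pj ← count-some (p − i) (ℕ.≤-pred (subst (2 ≤_) (count-remove p pi) 2≤p)) =
  i , j , i≢j , pi , proj₁ (true∧ pj)
  where
  i≢j : i ≢ j
  i≢j refl = contradiction (trans (sym (==-refl i)) (not-true (proj₂ (true∧ {p i} pj)))) true≢false

count≡1 : ∀ {m} (p : Fin m → Bool) → count p ≡ 1 → ∃ λ i → p i ≡ true × (∀ j → j ≢ i → p j ≡ false)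
count≡1 p p≡1 with i , pi ← count-some p (ℕ.≤-reflexive (sym p≡1)) =
  i , pi , λ j j≢i → trans (sym (−-≢ p j≢i)) (count≡0 (p − i) (ℕ.suc-injective (trans (sym (count-remove p pi)) p≡1)) j)

count≡2 : ∀ {m} (p : Fin m → Bool) → count p ≡ 2 →
          ∃₂ λ i j → i ≢ j × p i ≡ true × p j ≡ true × (∀ l → l ≢ i → l ≢ j → p l ≡ false)
count≡2 p p≡2 with i , pi ← count-some p (ℕ.≤-trans (s≤s z≤n) (ℕ.≤-reflexive (sym p≡2)))
              with j , pj , others ← count≡1 (p − i) (ℕ.suc-injective (trans (sym (count-remove p pi)) p≡2)) =
  i , j , i≢j , pi , proj₁ (true∧ pj) , λ l l≢i l≢j → trans (sym (−-≢ p l≢i)) (others l l≢j)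
  where
  i≢j : i ≢ j
  i≢j refl = contradiction (trans (sym (==-refl i)) (not-true (proj₂ (true∧ {p i} pj)))) true≢false

count-+ : ∀ {m} (p q r : Fin m → Bool) → (∀ i → 𝟙 (p i) ≡ 𝟙 (q i) + 𝟙 (r i)) → count p ≡ count q + count r
count-+ p q r p≡q+r = trans (Σℕ.sum-cong-≗ p≡q+r) (Σℕ.∑-distrib-+ (𝟙 ∘ q) (𝟙 ∘ r))

-- Sides are functions, so the search runs over vectors instead; `P` must respect pointwise equality
-- to be carried from one to the other.
anySide? : ∀ {n} {P : Side n → Set} → (∀ S → Dec (P S)) → (∀ {S S′} → S ≗ S′ → P S → P S′) → Dec (∃ P)
anySide? P? resp = map′
  (λ (S , PS) → lookup S , PS)
  (λ (S , PS) → tabulate S , resp (sym ∘ lookup∘tabulate S) PS)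
  (anySubset? (P? ∘ lookup))

smallest : ∀ {n} {P : Side n → Set} → (∀ S → Dec (P S)) → (∀ {S S′} → S ≗ S′ → P S → P S′) →
           ∀ S → P S → ∃ λ S′ → P S′ × (∀ S″ → count S″ < count S′ → ¬ P S″)
smallest {n} {P} P? resp S = go (count S) S ℕ.≤-refl
  where
  go : ∀ fuel S → count S ≤ fuel → P S → ∃ λ S′ → P S′ × (∀ S″ → count S″ < count S′ → ¬ P S″)
  go fuel S S≤fuel PS with anySide? (λ S″ → (count S″ ℕ.<? count S) ×-dec P? S″)
    (λ S≗ (lt , p) → subst (_< count S) (Σℕ.sum-cong-≗ (cong 𝟙 ∘ S≗)) lt , resp S≗ p)
  go fuel       S S≤fuel PS | no none = S , PS , λ S″ lt p → none (S″ , lt , p)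
  go zero       S S≤fuel PS | yes (S″ , lt , p) = contradiction (ℕ.≤-trans lt S≤fuel) λ ()
  go (suc fuel) S S≤fuel PS | yes (S″ , lt , p) = go fuel S″ (ℕ.≤-pred (ℕ.≤-trans lt S≤fuel)) p

-- Growing a set

infixl 6 _∪ₛ_ _⊹_ _⊻_
_∪ₛ_ _⊻_ : ∀ {n} → Side n → Side n → Side n
(S ∪ₛ S′) v = S v ∨ S′ v
(S ⊻ S′) v = S v xor S′ v

⁅_⁆ : ∀ {n} → Fin n → Side n
⁅ v ⁆ u = u == v

_⊹_ : ∀ {n} → Side n → Fin n → Side n
S ⊹ v = S ∪ₛ ⁅ v ⁆

⊹-new : ∀ {n} (S : Side n) v → (S ⊹ v) v ≡ true
⊹-new S v = ∨-trueʳ (S v) (==-refl v)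

⊹-cases : ∀ {n} (S : Side n) v {u} → (S ⊹ v) u ≡ true → S u ≡ true ⊎ u ≡ v
⊹-cases S v Su = [ inj₁ , (λ eq → inj₂ (==-sound eq)) ]′ (true∨ Su)

size-co : ∀ {n} → Side n → ℕ
size-co S = count (not ∘ S)

size-co-< : ∀ {n} (S S′ : Side n) → (∀ u → S u ≡ true → S′ u ≡ true) →
            ∀ v → S v ≡ false → S′ v ≡ true → size-co S′ < size-co S
size-co-< S S′ S⊆S′ v Sv S′v =
  count-strict (not ∘ S′) (not ∘ S) (λ u → shrink (S u) (S′ u) (S⊆S′ u)) v (cong not Sv) (cong not S′v)
  where
  shrink : ∀ a b → (a ≡ true → b ≡ true) → not b ≡ true → not a ≡ true
  shrink false b     a⊆b _ = refl
  shrink true  false a⊆b _ = contradiction (sym (a⊆b refl)) true≢false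

-- The common loop of connected components, augmenting walks and reachability. It ends because every
-- step shrinks the complement.
grow : ∀ {n} {Inv Done : Side n → Set} →
       (∀ S → Inv S → (∃ λ v → S v ≡ false × Inv (S ⊹ v)) ⊎ Done S) →
       ∀ S → Inv S → ∃ λ S′ → Inv S′ × Done S′
grow {n} {Inv} {Done} step S = go (size-co S) S ℕ.≤-refl
  where
  go : ∀ fuel S → size-co S ≤ fuel → Inv S → ∃ λ S′ → Inv S′ × Done S′
  go fuel S ≤fuel inv with step S inv
  go fuel S ≤fuel inv | inj₂ done = S , inv , done
  go zero S ≤fuel inv | inj₁ (v , Sv , inv′) =
    contradiction (ℕ.≤-trans (size-co-< S (S ⊹ v) (λ u → ∨-trueˡ _) v Sv (⊹-new S v)) ≤fuel) λ ()
  go (suc fuel) S ≤fuel inv | inj₁ (v , Sv , inv′) =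
    go fuel (S ⊹ v) (ℕ.≤-pred (ℕ.≤-trans (size-co-< S (S ⊹ v) (λ u → ∨-trueˡ _) v Sv (⊹-new S v)) ≤fuel)) inv′

-- Cuts of multigraphs and orthogonality over F₂

record Multigraph (n m : ℕ) : Set where
  field
    src tgt : Fin m → Fin n

open Multigraph

module _ {n m} (G : Multigraph n m) where

  cross : Side n → Fin m → Bool
  cross S e = S (src G e) xor S (tgt G e)

  within : Side n → Fin m → Bool
  within S e = S (src G e) ∧ S (tgt G e)

  -- The bilinear pairing over F₂ of an edge vector with the cut of `S`. Orthogonality to every `S`
  -- says that `φ` is a flow; for `S = ⁅ v ⁆` it is conservation at `v`.
  pair : (Fin m → Bool) → Side n → Bool
  pair φ S = ⨁ λ e → φ e ∧ cross S e

  infix 4 _⟂_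
  _⟂_ : (Fin m → Bool) → Side n → Set
  φ ⟂ S = pair φ S ≡ false

  within-mono : ∀ S S′ → (∀ u → S u ≡ true → S′ u ≡ true) → ∀ e → within S e ≡ true → within S′ e ≡ true
  within-mono S S′ S⊆S′ e eq with Ss , St ← true∧ {S (src G e)} eq = ∧-true (S⊆S′ _ Ss) (S⊆S′ _ St)

  within⇒¬cross : ∀ S e → within S e ≡ true → cross S e ≡ false
  within⇒¬cross S e eq with Ss , St ← true∧ {S (src G e)} eq = xor-≡ (trans Ss (sym St))

  cross-≗ : ∀ {S S′} → S ≗ S′ → ∀ e → cross S e ≡ cross S′ e
  cross-≗ S≗S′ e = cong₂ _xor_ (S≗S′ _) (S≗S′ _)

  ⟂-≗ : ∀ φ {S S′} → S ≗ S′ → φ ⟂ S → φ ⟂ S′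
  ⟂-≗ φ S≗S′ φ⟂S = trans (⊕.sum-cong-≗ (λ e → cong (φ e ∧_) (sym (cross-≗ S≗S′ e)))) φ⟂S

  ⟂-no-edges : ∀ φ S → (∀ e → cross S e ≡ false) → φ ⟂ S
  ⟂-no-edges φ S none = sum-zero xor-commutativeMonoid _ λ e → trans (cong (φ e ∧_) (none e)) (Bool.∧-zeroʳ (φ e))

  pair-⊻ : ∀ φ S S′ → pair φ (S ⊻ S′) ≡ pair φ S xor pair φ S′
  pair-⊻ φ S S′ = trans (⊕.sum-cong-≗ λ e → expand (φ e) (S (src G e)) (S′ (src G e)) (S (tgt G e)) (S′ (tgt G e)))
                        (⊕.∑-distrib-+ (λ e → φ e ∧ cross S e) _)
    where
    open xor-∧-Solver
    expand : ∀ p s s′ t t′ → p ∧ ((s xor s′) xor (t xor t′)) ≡ (p ∧ (s xor t)) xor (p ∧ (s′ xor t′))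
    expand = solve 5 (λ p s s′ t t′ → p :* ((s :+ s′) :+ (t :+ t′)) := (p :* (s :+ t)) :+ (p :* (s′ :+ t′))) refl

  pair-xor : ∀ φ ψ S → pair (λ e → φ e xor ψ e) S ≡ pair φ S xor pair ψ S
  pair-xor φ ψ S = trans (⊕.sum-cong-≗ λ e → Bool.∧-distribʳ-xor (cross S e) (φ e) (ψ e)) (⊕.∑-distrib-+ (λ e → φ e ∧ cross S e) _)

  pair-cong : ∀ {φ ψ} S → (∀ e → cross S e ≡ true → φ e ≡ ψ e) → pair φ S ≡ pair ψ S
  pair-cong {φ} {ψ} S φ≡ψ = ⊕.sum-cong-≗ λ e → case e (cross S e) refl
    where
    case : ∀ e c → cross S e ≡ c → φ e ∧ c ≡ ψ e ∧ c
    case e true  eq = cong (_∧ true) (φ≡ψ e eq)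
    case e false eq = trans (Bool.∧-zeroʳ (φ e)) (sym (Bool.∧-zeroʳ (ψ e)))

  pair-point : ∀ e c S → pair (λ i → (i == e) ∧ c) S ≡ c ∧ cross S e
  pair-point e c S = trans
    (sum-point xor-commutativeMonoid _ e λ i i≢e → cong (λ b → (b ∧ c) ∧ cross S i) (==-≢ i≢e))
    (cong (λ b → (b ∧ c) ∧ cross S e) (==-refl e))

  -- The value at e, an edge of D, is changed so that φ becomes orthogonal to D.
  repair : (Fin m → Bool) → Side n → Fin m → Fin m → Bool
  repair φ D e i = φ i xor ((i == e) ∧ pair φ D)

  repair-≢ : ∀ φ D {e i} → i ≢ e → repair φ D e i ≡ φ i
  repair-≢ φ D {e} {i} i≢e = trans (cong (λ b → φ i xor (b ∧ pair φ D)) (==-≢ i≢e)) (Bool.xor-identityʳ (φ i))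

  repair-≡ : ∀ φ D e → repair φ D e e ≡ φ e xor pair φ D
  repair-≡ φ D e = cong (λ b → φ e xor (b ∧ pair φ D)) (==-refl e)

  -- A set S crossed by e is traded for S ⊻ D, which e does not cross.
  repair-⟂ : ∀ φ D e S → cross D e ≡ true →
             (cross S e ≡ false → φ ⟂ S) → (cross S e ≡ true → φ ⟂ S ⊻ D) → repair φ D e ⟂ S
  repair-⟂ φ D e S De no-cross crossing = trans (trans (pair-xor φ _ S) (cong (pair φ S xor_) (pair-point e (pair φ D) S)))
    (case (cross S e) refl)
    where
    case : ∀ c → cross S e ≡ c → pair φ S xor (pair φ D ∧ c) ≡ false
    case false eq = cong₂ _xor_ (no-cross eq) (Bool.∧-zeroʳ (pair φ D))
    case true  eq = trans (cong (pair φ S xor_) (Bool.∧-identityʳ _)) (trans (sym (pair-⊻ φ S D)) (crossing eq))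

-- Identifying and releasing vertex sets

-- The sides of the graph with `X` identified to one vertex are the sides of the original graph that
-- are constant on `X`. Testing against these alone replaces the quotient graph.
Const : ∀ {n} → Side n → Side n → Set
Const X S = ∀ u v → X u ≡ true → X v ≡ true → S u ≡ S v

Const-⊻ : ∀ {n} {X S S′ : Side n} → Const X S → Const X S′ → Const X (S ⊻ S′)
Const-⊻ cS cS′ u v Xu Xv = cong₂ _xor_ (cS u v Xu Xv) (cS′ u v Xu Xv)

Const-outside : ∀ {n} {X : Side n} (D : Side n) → (∀ u → X u ≡ true → D u ≡ false) → Const X D
Const-outside D out u v Xu Xv = trans (out u Xu) (sym (out v Xv))

Const-⁅⁆ : ∀ {n} {X : Side n} v → X v ≡ false → Const X ⁅ v ⁆
Const-⁅⁆ {X = X} v Xv = Const-outside ⁅ v ⁆ out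
  where
  out : ∀ u → X u ≡ true → (u == v) ≡ false
  out u Xu = ==-≢ {i = u} {v} λ { refl → contradiction (trans (sym Xu) Xv) true≢false }

Const-⊹ : ∀ {n} {R S : Side n} w v → R w ≡ true → Const R S → S w ≡ S v → Const (R ⊹ v) S
Const-⊹ {R = R} {S} w v Rw cS Sw≡Sv x y Rx Ry = trans (to-w x Rx) (sym (to-w y Ry))
  where
  to-w : ∀ x → (R ⊹ v) x ≡ true → S x ≡ S w
  to-w x Rx with ⊹-cases R v Rx
  ... | inj₁ Rx′  = cS x w Rx′ Rw
  ... | inj₂ refl = sym Sw≡Sv

-- Orients `e` from `w` inside `R` to `v` outside, so that later arguments need not distinguish
-- `src` from `tgt`.
cross-ends : ∀ {n m} (G : Multigraph n m) R e → cross G R e ≡ true →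
             ∃₂ λ w v → R w ≡ true × R v ≡ false × (∀ S → cross G S e ≡ S w xor S v) ×
               (∀ S → within G S e ≡ S w ∧ S v)
cross-ends G R e Re with xor-true Re
... | inj₁ (Rs , Rt) = src G e , tgt G e , Rs , Rt , (λ S → refl) , (λ S → refl)
... | inj₂ (Rs , Rt) = tgt G e , src G e , Rt , Rs , (λ S → Bool.xor-comm (S (src G e)) _) , (λ S → Bool.∧-comm (S (src G e)) _)

-- Releases `v` from the identified class `R ⊹ v`. While `w` and `v` were identified `e` was a loop
-- with a free value; this value now takes up the defect at `v`. A side that separates `w` from `v`
-- is reduced to one that does not by adding `⁅ v ⁆`.
repair-⊹ : ∀ {n m} (G : Multigraph n m) φ {R X : Side n} e {w v} →
           R w ≡ true → R v ≡ false → X v ≡ false → (∀ S → cross G S e ≡ S w xor S v) →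
           (∀ S → Const X S → Const (R ⊹ v) S → _⟂_ G φ S) →
           ∀ S → Const X S → Const R S → _⟂_ G (repair G φ ⁅ v ⁆ e) S
repair-⊹ G φ {R} {X} e {w} {v} Rw Rv Xv ends φ⟂ S cX cR = repair-⟂ G φ ⁅ v ⁆ e S De
    (λ Se → φ⟂ S cX (Const-⊹ w v Rw cR (xor-false (trans (sym (ends S)) Se))))
    (λ Se → φ⟂ (S ⊻ ⁅ v ⁆) (Const-⊻ cX (Const-⁅⁆ v Xv))
       (Const-⊹ w v Rw (Const-⊻ cR (Const-⁅⁆ v Rv))
         (merge (S w) (S v) (w == v) (v == v) (trans (sym (ends S)) Se) w≢v (==-refl v))))
  where
  w≢v : (w == v) ≡ false
  w≢v = ==-≢ {i = w} {v} λ { refl → contradiction (trans (sym Rw) Rv) true≢false }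

  De : cross G ⁅ v ⁆ e ≡ true
  De = trans (ends ⁅ v ⁆) (cong₂ _xor_ w≢v (==-refl v))

  merge : ∀ s t a b → s xor t ≡ true → a ≡ false → b ≡ true → s xor a ≡ t xor b
  merge true  false _ _ _ refl refl = refl
  merge false true  _ _ _ refl refl = refl

-- The class `R` can be released, with `X` kept identified, at the cost of changes on edges of `C`
-- inside `R` only.
LiftsAlong : ∀ {n m} (G : Multigraph n m) (X R : Side n) (C : Fin m → Bool) → Set
LiftsAlong {m = m} G X R C = ∀ (φ : Fin m → Bool) → (∀ S → Const X S → Const R S → _⟂_ G φ S) →
  Σ (Fin m → Bool) λ φ′ → (∀ e → C e ∧ within G R e ≡ false → φ′ e ≡ φ e) × (∀ S → Const X S → _⟂_ G φ′ S)

-- Each vertex enters `U` along an edge of `C`, and that edge later absorbs the defect at the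
-- vertex. These edges form a spanning tree of `U`, which is all that lifting needs.
component : ∀ {n m} (G : Multigraph n m) (X A : Side n) (C : Fin m → Bool) →
            (∀ e → C e ≡ true → within G A e ≡ true) → (∀ v → A v ≡ true → X v ≡ false) →
            ∀ b → A b ≡ true →
            ∃ λ U → U b ≡ true × (∀ v → U v ≡ true → A v ≡ true) × LiftsAlong G X U C ×
              (∀ e → C e ≡ true → cross G U e ≡ false)
component {n} {m} G X A C C⊆A A∩X b Ab =
  let U , (Ub , U⊆A , lifts) , closed = grow {Inv = Inv} {Done = Done} step ⁅ b ⁆ start in U , Ub , U⊆A , lifts , closed
  where
  Inv Done : Side n → Set
  Inv R = R b ≡ true × (∀ v → R v ≡ true → A v ≡ true) × LiftsAlong G X R C
  Done R = ∀ e → C e ≡ true → cross G R e ≡ false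

  start : Inv ⁅ b ⁆
  start = ==-refl b , (λ v eq → subst (λ x → A x ≡ true) (sym (==-sound eq)) Ab) ,
    λ φ φ⟂ → φ , (λ _ _ → refl) , λ S cX → φ⟂ S cX λ u v eu ev → cong S (trans (==-sound eu) (sym (==-sound ev)))

  step : ∀ R → Inv R → (∃ λ v → R v ≡ false × Inv (R ⊹ v)) ⊎ Done R
  step R (Rb , R⊆A , lifts) with any? (λ e → (C e ∧ cross G R e) Bool.≟ true)
  ... | no none = inj₂ λ e Ce → Bool.¬-not λ Re → none (e , ∧-true Ce Re)
  ... | yes (e , CRe) with Ce , Re ← true∧ {C e} CRe
                      with w , v , Rw , Rv , ends , inside ← cross-ends G R e Re =
    inj₁ (v , Rv , ∨-trueˡ _ Rb , (λ u Ru → [ R⊆A u , (λ { refl → Av }) ]′ (⊹-cases R v Ru)) , lifts′)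
    where
    Av : A v ≡ true
    Av = proj₂ (true∧ {A w} (trans (sym (inside A)) (C⊆A e Ce)))

    lifts′ : LiftsAlong G X (R ⊹ v) C
    -- The vertex added last is released first; what remains is the situation for `R`.
    lifts′ φ φ⟂ with φ′ , off , φ′⟂ ← lifts (repair G φ ⁅ v ⁆ e) (repair-⊹ G φ e Rw Rv (A∩X v Av) ends φ⟂) =
      φ′ , off′ , φ′⟂
      where
      off′ : ∀ i → C i ∧ within G (R ⊹ v) i ≡ false → φ′ i ≡ φ i
      off′ i eq = trans (off i (smaller (C i) (within G R i) (within G (R ⊹ v) i)
          (within-mono G R (R ⊹ v) (λ _ → ∨-trueˡ _) i) eq)) (repair-≢ G φ ⁅ v ⁆ i≢e)
        where
        smaller : ∀ c r r′ → (r ≡ true → r′ ≡ true) → c ∧ r′ ≡ false → c ∧ r ≡ false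
        smaller false r     r′    r⊆r′ eq = refl
        smaller true  false r′    r⊆r′ eq = refl
        smaller true  true  false r⊆r′ eq = sym (r⊆r′ refl)
        i≢e : i ≢ e
        i≢e refl = contradiction (trans (sym (∧-true Ce (trans (inside (R ⊹ v)) (∧-true (∨-trueˡ _ Rw) (⊹-new R v))))) eq) true≢false

-- Integer flows and their parity

odd : ℕ → Bool
odd zero    = false
odd (suc n) = not (odd n)

oddℤ : ℤ → Bool
oddℤ i = odd ℤ.∣ i ∣

odd-+ : ∀ a b → odd (a + b) ≡ odd a xor odd b
odd-+ zero    b = refl
odd-+ (suc a) b = trans (cong not (odd-+ a b)) (Bool.not-distribˡ-xor (odd a) (odd b))

odd-⊖ : ∀ a b → oddℤ (a ℤ.⊖ b) ≡ odd a xor odd b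
odd-⊖ zero    zero    = refl
odd-⊖ zero    (suc b) = refl
odd-⊖ (suc a) zero    = sym (Bool.xor-identityʳ _)
odd-⊖ (suc a) (suc b) = trans (cong oddℤ (ℤ.[1+m]⊖[1+n]≡m⊖n a b))
  (trans (odd-⊖ a b) (sym (Bool.xor-annihilates-not (odd a) (odd b))))

oddℤ-+ : ∀ i j → oddℤ (i ℤ.+ j) ≡ oddℤ i xor oddℤ j
oddℤ-+ (+ a)       (+ b)       = odd-+ a b
oddℤ-+ (+ a)       ℤ.-[1+ b ]  = odd-⊖ a (suc b)
oddℤ-+ ℤ.-[1+ a ]  (+ b)       = trans (odd-⊖ b (suc a)) (Bool.xor-comm (odd b) _)
oddℤ-+ ℤ.-[1+ a ]  ℤ.-[1+ b ]  = trans (cong (not ∘ not) (odd-+ a b))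
  (trans (Bool.not-involutive _) (sym (Bool.xor-annihilates-not (odd a) (odd b))))

oddℤ-sum : ∀ {m} (f : Fin m → ℤ) → oddℤ (Σℤ.sum f) ≡ ⨁ (oddℤ ∘ f)
oddℤ-sum {zero}  f = refl
oddℤ-sum {suc m} f = trans (oddℤ-+ (f zero) _) (cong (oddℤ (f zero) xor_) (oddℤ-sum (f ∘ suc)))

-- Unit capacity in both directions: `pos` runs from `src` to `tgt`, `neg` backwards.
data Sign : Set where
  neg zer pos : Sign

val : Sign → ℤ
val neg = -1ℤ
val zer = 0ℤ
val pos = 1ℤ

⟦_⟧ : Bool → ℤ
⟦ true ⟧  = 1ℤ
⟦ false ⟧ = 0ℤ

pos? : ∀ s → Dec (s ≡ pos)
pos? neg = no λ ()
pos? zer = no λ ()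
pos? pos = yes refl

neg? : ∀ s → Dec (s ≡ neg)
neg? neg = yes refl
neg? zer = no λ ()
neg? pos = no λ ()

raise : ∀ s → s ≢ pos → ∃ λ s′ → val s′ ≡ val s ℤ.+ 1ℤ
raise neg s≢pos = zer , refl
raise zer s≢pos = pos , refl
raise pos s≢pos = contradiction refl s≢pos

lower : ∀ s → s ≢ neg → ∃ λ s′ → val s′ ≡ val s ℤ.+ -1ℤ
lower neg s≢neg = contradiction refl s≢neg
lower zer s≢neg = neg , refl
lower pos s≢neg = zer , refl

Σ-𝟙 : ∀ {m} (p : Fin m → Bool) → Σℤ.sum (λ e → ⟦ p e ⟧) ≡ + count p
Σ-𝟙 {zero}  p = refl
Σ-𝟙 {suc m} p with p zero
... | true  = cong (λ x → 1ℤ ℤ.+ x) (Σ-𝟙 (p ∘ suc))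
... | false = trans (ℤ.+-identityˡ _) (Σ-𝟙 (p ∘ suc))

_[_↦_] : ∀ {m} → (Fin m → Sign) → Fin m → Sign → Fin m → Sign
(f [ e ↦ s ]) i = if i == e then s else f i

[↦]-≢ : ∀ {m} (f : Fin m → Sign) {e i s} → i ≢ e → (f [ e ↦ s ]) i ≡ f i
[↦]-≢ f {s = s} i≢e = cong (λ b → if b then s else f _) (==-≢ i≢e)

module _ {n m} (G : Multigraph n m) where

  outflow : (Fin m → Sign) → Side n → Fin m → ℤ
  outflow f U e = val (f e) ℤ.* (⟦ U (src G e) ⟧ ℤ.- ⟦ U (tgt G e) ⟧)

  net : (Fin m → Sign) → Side n → ℤ
  net f U = Σℤ.sum (outflow f U)

  net-[↦] : ∀ f e s d U → val s ≡ val (f e) ℤ.+ d →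
            net (f [ e ↦ s ]) U ≡ net f U ℤ.+ d ℤ.* (⟦ U (src G e) ⟧ ℤ.- ⟦ U (tgt G e) ⟧)
  net-[↦] f e s d U vs = begin
    net (f [ e ↦ s ]) U                                ≡⟨ Σℤ.sum-cong-≗ split ⟩
    Σℤ.sum (λ i → outflow f U i ℤ.+ extra i)           ≡⟨ Σℤ.∑-distrib-+ (outflow f U) extra ⟩
    net f U ℤ.+ Σℤ.sum extra                           ≡⟨ cong (λ x → net f U ℤ.+ x) (sum-point ℤ.+-0-commutativeMonoid extra e λ i i≢e → extra-off (==-≢ i≢e)) ⟩
    net f U ℤ.+ extra e                                ≡⟨ cong (λ b → net f U ℤ.+ (if b then D e else 0ℤ)) (==-refl e) ⟩
    net f U ℤ.+ D e                                    ∎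
    where
    open ≡-Reasoning
    D extra : Fin m → ℤ
    D i = d ℤ.* (⟦ U (src G i) ⟧ ℤ.- ⟦ U (tgt G i) ⟧)
    extra i = if i == e then D i else 0ℤ
    extra-off : ∀ {i} → (i == e) ≡ false → extra i ≡ 0ℤ
    extra-off eq = cong (λ b → if b then D _ else 0ℤ) eq
    split : ∀ i → outflow (f [ e ↦ s ]) U i ≡ outflow f U i ℤ.+ extra i
    split i with i ≟ e
    ... | yes refl = trans (cong (ℤ._* _) vs) (ℤ.*-distribʳ-+ _ (val (f i)) d)
    ... | no  _    = sym (ℤ.+-identityʳ _)

  Saturated : (Fin m → Sign) → Side n → Fin m → Set
  Saturated f R e = outflow f R e ≡ 1ℤ

  -- Either `e` already carries its full unit out of `R`, or one more unit can be pushed from `w` to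
  -- `v`. The effect is stated for every `g` that agrees with `f` on `e`, because the push is
  -- applied to a flow already rerouted inside `R`.
  saturated-or-push : ∀ f R e → cross G R e ≡ true → Saturated f R e ⊎
    (∃ λ s → ∃₂ λ w v → R w ≡ true × R v ≡ false × (∀ S → within G S e ≡ S w ∧ S v) ×
      (∀ g → g e ≡ f e → ∀ U → net (g [ e ↦ s ]) U ≡ net g U ℤ.+ (⟦ U w ⟧ ℤ.- ⟦ U v ⟧)))
  saturated-or-push f R e Re with xor-true {R (src G e)} Re
  ... | inj₁ (Rs , Rt) with pos? (f e)
  ...   | yes fe = inj₁ (saturated Rs Rt)
    where
    saturated : R (src G e) ≡ true → R (tgt G e) ≡ false → Saturated f R e
    saturated Rs Rt rewrite fe | Rs | Rt = refl
  ...   | no fe with s , vs ← raise (f e) fe = inj₂ (s , src G e , tgt G e , Rs , Rt , (λ S → refl) , λ g ge U →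
          trans (net-[↦] g e s 1ℤ U (trans vs (cong (λ x → val x ℤ.+ 1ℤ) (sym ge)))) (cong (λ x → net g U ℤ.+ x) (ℤ.*-identityˡ _)))
  saturated-or-push f R e Re | inj₂ (Rs , Rt) with neg? (f e)
  ...   | yes fe = inj₁ (saturated Rs Rt)
    where
    saturated : R (src G e) ≡ false → R (tgt G e) ≡ true → Saturated f R e
    saturated Rs Rt rewrite fe | Rs | Rt = refl
  ...   | no fe with s , vs ← lower (f e) fe = inj₂ (s , tgt G e , src G e , Rt , Rs , (λ S → Bool.∧-comm (S (src G e)) _) , λ g ge U →
          trans (net-[↦] g e s -1ℤ U (trans vs (cong (λ x → val x ℤ.+ -1ℤ) (sym ge))))
                (cong (λ x → net g U ℤ.+ x) (flip-sign ⟦ U (src G e) ⟧ ⟦ U (tgt G e) ⟧)))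
    where
    open ℤ.+-*-Solver using (solve; con; _:=_; _:+_; _:*_; _:-_)
    flip-sign : ∀ a b → -1ℤ ℤ.* (a ℤ.- b) ≡ b ℤ.- a
    flip-sign = solve 2 (λ a b → con -1ℤ :* (a :- b) := b :- a) refl

  module _ (A : Side n) (b₁ b₂ : Fin n) (A₁ : A b₁ ≡ true)
           (two : ∀ R → (∀ v → R v ≡ true → A v ≡ true) → R b₁ ≡ true → R b₂ ≡ false →
                  2 ≤ count (λ e → within G A e ∧ cross G R e)) where

    Supported : (Fin m → Sign) → Set
    Supported f = ∀ e → within G A e ≡ false → f e ≡ zer

    -- A flow of value `k` from `b₁` to `b₂`, again in cut form: the net amount leaving `U` depends
    -- only on which of the two ends lie in `U`.
    FlowOf : ℤ → (Fin m → Sign) → Set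
    FlowOf k f = Supported f × (∀ U → net f U ≡ k ℤ.* (⟦ U b₁ ⟧ ℤ.- ⟦ U b₂ ⟧))

    -- Ford–Fulkerson: every vertex w of R is the end of an augmented flow that differs from f only
    -- inside R.
    augment : ∀ k → k ℕ.< 2 → ∀ f → FlowOf (+ k) f → ∃ (FlowOf (+ suc k))
    augment k k<2 f (supp , flow) = conclude (grow {Inv = Inv} {Done = Done} step ⁅ b₁ ⁆ start)
      where
      Inv Done : Side n → Set
      Inv R = R b₁ ≡ true × (∀ v → R v ≡ true → A v ≡ true) × (∀ w → R w ≡ true →
        Σ (Fin m → Sign) λ g → Supported g × (∀ e → within G R e ≡ false → g e ≡ f e) ×
          (∀ U → net g U ≡ + k ℤ.* (⟦ U b₁ ⟧ ℤ.- ⟦ U b₂ ⟧) ℤ.+ (⟦ U b₁ ⟧ ℤ.- ⟦ U w ⟧)))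
      Done R = ∀ e → within G A e ≡ true → cross G R e ≡ true → Saturated f R e

      start : Inv ⁅ b₁ ⁆
      start = ==-refl b₁ , (λ v eq → subst (λ x → A x ≡ true) (sym (==-sound eq)) A₁) ,
        λ w eq → f , supp , (λ _ _ → refl) , λ U → trans (flow U) (no-move (+ k ℤ.* (⟦ U b₁ ⟧ ℤ.- ⟦ U b₂ ⟧)) U (==-sound {i = w} eq))
        where
        no-move : ∀ x U {w} → w ≡ b₁ → x ≡ x ℤ.+ (⟦ U b₁ ⟧ ℤ.- ⟦ U w ⟧)
        no-move x U refl = sym (trans (cong (λ y → x ℤ.+ y) (ℤ.+-inverseʳ ⟦ U b₁ ⟧)) (ℤ.+-identityʳ x))

      step : ∀ R → Inv R → (∃ λ v → R v ≡ false × Inv (R ⊹ v)) ⊎ Done R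
      step R (R₁ , R⊆A , flows) with any? (λ e → (within G A e ∧ cross G R e) Bool.≟ true ×-dec ¬? (outflow f R e ℤ.≟ 1ℤ))
      ... | no none = inj₂ λ e Ae Re → Dec.decidable-stable (outflow f R e ℤ.≟ 1ℤ) λ ¬sat → none (e , ∧-true Ae Re , ¬sat)
      ... | yes (e , ARe , ¬sat) with Ae , Re ← true∧ {within G A e} ARe with saturated-or-push f R e Re
      ...   | inj₁ sat = contradiction sat ¬sat
      ...   | inj₂ (s , w , v , Rw , Rv , inside , push) =
        inj₁ (v , Rv , ∨-trueˡ _ R₁ , (λ u Ru → [ R⊆A u , (λ { refl → Av }) ]′ (⊹-cases R v Ru)) , flows′)
        where
        Av : A v ≡ true
        Av = proj₂ (true∧ {A w} (trans (sym (inside A)) Ae))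
        R⊆⊹ : ∀ i → within G (R ⊹ v) i ≡ false → within G R i ≡ false
        R⊆⊹ i eq = Bool.¬-not λ Ri → contradiction (trans (sym (within-mono G R (R ⊹ v) (λ _ → ∨-trueˡ _) i Ri)) eq) true≢false
        flows′ : ∀ x → (R ⊹ v) x ≡ true → _
        flows′ x Rx with ⊹-cases R v Rx
        ... | inj₁ Rx′ with g , gsupp , off , gflow ← flows x Rx′ = g , gsupp , (λ i → off i ∘ R⊆⊹ i) , gflow
        ... | inj₂ refl with g , gsupp , off , gflow ← flows w Rw = g [ e ↦ s ] , supp′ , off′ , flow′
          where
          supp′ : Supported (g [ e ↦ s ])
          supp′ i Ai = trans ([↦]-≢ g λ { refl → contradiction (trans (sym Ae) Ai) true≢false }) (gsupp i Ai)
          off′ : ∀ i → within G (R ⊹ v) i ≡ false → (g [ e ↦ s ]) i ≡ f i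
          off′ i Ri = trans
            ([↦]-≢ g λ { refl → contradiction (trans (sym (trans (inside (R ⊹ v)) (∧-true (∨-trueˡ _ Rw) (⊹-new R v)))) Ri) true≢false })
            (off i (R⊆⊹ i Ri))
          ge : g e ≡ f e
          ge = off e (Bool.¬-not λ Re′ → contradiction (trans (sym Re) (within⇒¬cross G R e Re′)) true≢false)
          flow′ : ∀ U → net (g [ e ↦ s ]) U ≡ + k ℤ.* (⟦ U b₁ ⟧ ℤ.- ⟦ U b₂ ⟧) ℤ.+ (⟦ U b₁ ⟧ ℤ.- ⟦ U v ⟧)
          flow′ U = trans (push g ge U) (trans (cong (ℤ._+ _) (gflow U)) (telescope (+ k ℤ.* (⟦ U b₁ ⟧ ℤ.- ⟦ U b₂ ⟧)) ⟦ U b₁ ⟧ ⟦ U w ⟧ ⟦ U v ⟧))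
            where
            open ℤ.+-*-Solver using (solve; con; _:=_; _:+_; _:*_; _:-_)
            telescope : ∀ a b c d → a ℤ.+ (b ℤ.- c) ℤ.+ (c ℤ.- d) ≡ a ℤ.+ (b ℤ.- d)
            telescope = solve 4 (λ a b c d → a :+ (b :- c) :+ (c :- d) := a :+ (b :- d)) refl

      conclude : (∃ λ R → Inv R × Done R) → ∃ (FlowOf (+ suc k))
      conclude (R , (R₁ , R⊆A , flows) , closed) with R b₂ in eq
      ... | true with g , gsupp , _ , gflow ← flows b₂ eq = g , gsupp , λ U →
              trans (gflow U) (collect (+ k) (⟦ U b₁ ⟧ ℤ.- ⟦ U b₂ ⟧))
        where
        open ℤ.+-*-Solver using (solve; con; _:=_; _:+_; _:*_; _:-_)
        collect : ∀ k d → k ℤ.* d ℤ.+ d ≡ (1ℤ ℤ.+ k) ℤ.* d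
        collect = solve 2 (λ k d → k :* d :+ d := (con 1ℤ :+ k) :* d) refl
      -- The search stopped short of `b₂`, so every edge of `A` leaving `R` is saturated. The cut
      -- then has exactly as many edges as the value of the flow, namely `k`, which is less than 2.
      ... | false = contradiction (two R R⊆A R₁ eq) (ℕ.<⇒≱ (subst (ℕ._< 2) (sym count≡k) k<2))
        where
        saturate : ∀ e → outflow f R e ≡ ⟦ within G A e ∧ cross G R e ⟧
        saturate e with within G A e in Ae | cross G R e in Re
        ... | false | _     rewrite supp e Ae = refl
        ... | true  | true  = closed e Ae Re
        ... | true  | false rewrite xor-false {R (src G e)} Re = trans (cong (val (f e) ℤ.*_) (ℤ.+-inverseʳ ⟦ R (tgt G e) ⟧)) (ℤ.*-zeroʳ (val (f e)))
        count≡k : count (λ e → within G A e ∧ cross G R e) ≡ k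
        count≡k = ℤ.+-injective (begin
          + count (λ e → within G A e ∧ cross G R e)  ≡⟨ Σ-𝟙 (λ e → within G A e ∧ cross G R e) ⟨
          Σℤ.sum (λ e → ⟦ within G A e ∧ cross G R e ⟧) ≡⟨ Σℤ.sum-cong-≗ saturate ⟨
          net f R                                     ≡⟨ flow R ⟩
          + k ℤ.* (⟦ R b₁ ⟧ ℤ.- ⟦ R b₂ ⟧)             ≡⟨ cong₂ (λ x y → + k ℤ.* (⟦ x ⟧ ℤ.- ⟦ y ⟧)) R₁ eq ⟩
          + k ℤ.* 1ℤ                                  ≡⟨ ℤ.*-identityʳ (+ k) ⟩
          + k                                         ∎)
          where open ≡-Reasoning

    twoFlow : ∃ (FlowOf (+ 2))
    twoFlow with f , flow ← augment 0 (s≤s z≤n) (λ _ → zer)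
      ((λ _ _ → refl) , λ U → sum-zero ℤ.+-0-commutativeMonoid (outflow (λ _ → zer) U) (λ _ → refl)) = augment 1 ℕ.≤-refl f flow

    -- `C` is the support of the flow of value 2: as values are -1, 0 or 1, it is also the set of
    -- edges with odd value. It is even because every net amount is a multiple of 2, and it meets
    -- each side separating `b₁` from `b₂` because the net amount there is not 0.
    evenThrough : ∃ λ (C : Fin m → Bool) → (∀ e → C e ≡ true → within G A e ≡ true) × (∀ U → _⟂_ G C U) ×
                  (∀ U → U b₁ ≡ true → U b₂ ≡ false → ∃ λ e → C e ≡ true × cross G U e ≡ true)
    evenThrough with f , supp , flow ← twoFlow = oddℤ ∘ val ∘ f , sub , even , meets
      where
      sub : ∀ e → oddℤ (val (f e)) ≡ true → within G A e ≡ true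
      sub e odd-e with within G A e in Ae
      ... | true  = refl
      ... | false rewrite supp e Ae = odd-e
      even : ∀ U → _⟂_ G (oddℤ ∘ val ∘ f) U
      even U = trans (⊕.sum-cong-≗ λ e → sym (term (f e) (U (src G e)) (U (tgt G e))))
        (trans (sym (oddℤ-sum (outflow f U))) (trans (cong oddℤ (flow U)) (double (U b₁) (U b₂))))
        where
        term : ∀ s a b → oddℤ (val s ℤ.* (⟦ a ⟧ ℤ.- ⟦ b ⟧)) ≡ oddℤ (val s) ∧ (a xor b)
        term neg false false = refl
        term neg false true  = refl
        term neg true  false = refl
        term neg true  true  = refl
        term zer a     b     = refl
        term pos false false = refl
        term pos false true  = refl
        term pos true  false = refl
        term pos true  true  = refl
        double : ∀ a b → oddℤ (+ 2 ℤ.* (⟦ a ⟧ ℤ.- ⟦ b ⟧)) ≡ false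
        double false false = refl
        double false true  = refl
        double true  false = refl
        double true  true  = refl
      meets : ∀ U → U b₁ ≡ true → U b₂ ≡ false → ∃ λ e → oddℤ (val (f e)) ≡ true × cross G U e ≡ true
      meets U U₁ U₂ with any? (λ e → (oddℤ (val (f e)) ∧ cross G U e) Bool.≟ true)
      ... | yes (e , eq) = e , true∧ eq
      ... | no none = contradiction (trans (sym (sum-zero ℤ.+-0-commutativeMonoid _ λ e → vanish (f e) (U (src G e)) (U (tgt G e)) λ eq → none (e , eq)))
              (trans (flow U) (cong₂ (λ x y → + 2 ℤ.* (⟦ x ⟧ ℤ.- ⟦ y ⟧)) U₁ U₂))) λ ()
        where
        vanish : ∀ s a b → oddℤ (val s) ∧ (a xor b) ≢ true → val s ℤ.* (⟦ a ⟧ ℤ.- ⟦ b ⟧) ≡ 0ℤ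
        vanish zer a     b     _ = refl
        vanish neg false false _ = refl
        vanish neg true  true  _ = refl
        vanish neg false true  h = contradiction refl h
        vanish neg true  false h = contradiction refl h
        vanish pos false false _ = refl
        vanish pos true  true  _ = refl
        vanish pos false true  h = contradiction refl h
        vanish pos true  false h = contradiction refl h

-- Seymour's growth of the identified set

module _ {n m} (G : Multigraph n m) where

  link : Side n → Side n → Fin m → Bool
  link A B e = (A (src G e) ∧ B (tgt G e)) ∨ (A (tgt G e) ∧ B (src G e))

  link-ends : ∀ A B e → link A B e ≡ true → ∃₂ λ a b → A a ≡ true × B b ≡ true ×
              (∀ S → cross G S e ≡ S a xor S b) × (∀ S → within G S e ≡ S a ∧ S b)
  link-ends A B e eq with true∨ {A (src G e) ∧ B (tgt G e)} eq
  ... | inj₁ p with As , Bt ← true∧ {A (src G e)} p = src G e , tgt G e , As , Bt , (λ S → refl) , λ S → refl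
  ... | inj₂ p with At , Bs ← true∧ {A (tgt G e)} p =
    tgt G e , src G e , At , Bs , (λ S → Bool.xor-comm (S (src G e)) _) , λ S → Bool.∧-comm (S (src G e)) _

  link-≗ : ∀ {A A′ B B′} → A ≗ A′ → B ≗ B′ → ∀ e → link A B e ≡ link A′ B′ e
  link-≗ A≗ B≗ e = cong₂ _∨_ (cong₂ _∧_ (A≗ _) (B≗ _)) (cong₂ _∧_ (A≗ _) (B≗ _))

  touches : Side n → Fin m → Bool
  touches X e = X (src G e) ∨ X (tgt G e)

  -- f₂ and f₃ are flows of the graph obtained by identifying X to one vertex, while f₁ avoids X, so
  -- that it stays a flow when part of X is released again.
  record Partial (X : Side n) : Set where
    field
      f₁ f₂ f₃ : Fin m → Bool
      even₁    : ∀ S → _⟂_ G f₁ S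
      even₂    : ∀ S → Const X S → _⟂_ G f₂ S
      even₃    : ∀ S → Const X S → _⟂_ G f₃ S
      vanish   : ∀ e → touches X e ≡ true → f₁ e ≡ false
      nonzero  : ∀ e → within G X e ≡ false → f₁ e ∨ f₂ e ∨ f₃ e ≡ true

  -- Edges inside `Y` are loops once `Y` is identified: no side constant on `Y` is crossed by them,
  -- so their values are arbitrary.
  refill : ∀ {Y φ ψ} → (∀ e → within G Y e ≡ false → ψ e ≡ φ e) →
           (∀ S → Const Y S → _⟂_ G φ S) → ∀ S → Const Y S → _⟂_ G ψ S
  refill {Y} ψ≡φ φ⟂ S cY = trans (pair-cong G S λ e Se → ψ≡φ e (Bool.¬-not λ Ye →
    let Ys , Yt = true∧ {Y (src G e)} Ye in
    contradiction (trans (sym Se) (xor-≡ (cY _ _ Ys Yt))) true≢false)) (φ⟂ S cY)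

  touches-mono : ∀ X Y → (∀ u → X u ≡ true → Y u ≡ true) → ∀ e → touches X e ≡ true → touches Y e ≡ true
  touches-mono X Y X⊆Y e eq =
    [ (λ Xs → ∨-trueˡ (Y (tgt G e)) (X⊆Y _ Xs)) , (λ Xt → ∨-trueʳ (Y (src G e)) (X⊆Y _ Xt)) ]′ (true∨ {X (src G e)} eq)

  zero-⟂ : ∀ S → _⟂_ G (λ _ → false) S
  zero-⟂ S = sum-zero xor-commutativeMonoid {m} (λ e → false ∧ cross G S e) (λ _ → refl)

  module _ (X : Side n) where

    rest : Side n → Side n
    rest S v = not (S v ∨ X v)

    into : Side n → Fin m → Bool
    into S = link S (rest S)

    -- A smallest candidate is a leaf, or an isolated node, of the forest formed by the
    -- 2-edge-connected components of `G` without `X` and the bridges between them.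
    Candidate : Side n → Set
    Candidate S = (∃ λ v → S v ≡ true) × (∀ v → S v ≡ true → X v ≡ false) × count (into S) ≤ 1

    candidate? : ∀ S → Dec (Candidate S)
    candidate? S = any? (λ v → S v Bool.≟ true) ×-dec (all? (λ v → (S v Bool.≟ true) →-dec (X v Bool.≟ false)) ×-dec (count (into S) ℕ.≤? 1))

    candidate-≗ : ∀ {S S′} → S ≗ S′ → Candidate S → Candidate S′
    candidate-≗ {S} {S′} S≗ ((v , Sv) , S∩X , few) =
      (v , trans (sym (S≗ v)) Sv) , (λ u S′u → S∩X u (trans (S≗ u) S′u)) ,
      subst (_≤ 1) (Σℕ.sum-cong-≗ λ e → cong 𝟙 (link-≗ S≗ (λ u → cong (λ b → not (b ∨ X u)) (S≗ u)) e)) few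

    module _ (S : Side n) (S∩X : ∀ v → S v ≡ true → X v ≡ false) where

      boundary : count (cross G S) ≡ count (link S X) + count (into S)
      boundary = count-+ (cross G S) (link S X) (into S) λ e →
          split (S (src G e)) (X (src G e)) (S (tgt G e)) (X (tgt G e)) (S∩X _) (S∩X _)
        where
        split : ∀ s x t y → (s ≡ true → x ≡ false) → (t ≡ true → y ≡ false) →
                𝟙 (s xor t) ≡ 𝟙 ((s ∧ y) ∨ (t ∧ x)) + 𝟙 ((s ∧ not (t ∨ y)) ∨ (t ∧ not (s ∨ x)))
        split true  true  _     _     p q = contradiction (p refl) true≢false
        split _     _     true  true  p q = contradiction (q refl) true≢false
        split true  false true  false p q = refl
        split true  false false true  p q = refl
        split true  false false false p q = refl
        split false true  true  false p q = refl
        split false false true  false p q = refl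
        split false true  false true  p q = refl
        split false true  false false p q = refl
        split false false false true  p q = refl
        split false false false false p q = refl

      -- Splitting a minimal candidate S at a cut with at most one edge inside S would leave a
      -- smaller candidate.
      inner-cuts : count (into S) ≤ 1 → (∀ S′ → count S′ < count S → ¬ Candidate S′) →
                   ∀ R → (∀ v → R v ≡ true → S v ≡ true) → ∀ b₁ b₂ → R b₁ ≡ true → S b₂ ≡ true → R b₂ ≡ false →
                   2 ≤ count (λ e → within G S e ∧ cross G R e)
      inner-cuts few least R R⊆S b₁ b₂ Rb₁ Sb₂ Rb₂ = ℕ.≮⇒≥ λ c<2 →
        split a b c (subst (_≤ 1) whole few) (ℕ.≤-pred c<2)
          (λ a+c≤1 → least R (count-strict R S R⊆S b₂ Sb₂ Rb₂) ((b₁ , Rb₁) , (λ v → S∩X v ∘ R⊆S v) , subst (_≤ 1) (sym part₁) a+c≤1))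
          (λ b+c≤1 → least R′ (count-strict R′ S (λ v → proj₁ ∘ true∧) b₁ (R⊆S b₁ Rb₁) (trans (cong (λ r → S b₁ ∧ not r) Rb₁) (Bool.∧-zeroʳ _)))
            ((b₂ , ∧-true Sb₂ (cong not Rb₂)) , (λ v → S∩X v ∘ proj₁ ∘ true∧) , subst (_≤ 1) (sym part₂) b+c≤1))
        where
        R′ : Side n
        R′ v = S v ∧ not (R v)
        -- `a` and `b` count the edges by which the two halves `R` and `R′` leave `S` for the rest,
        -- `c` the edges between the halves. Since `a + b ≤ 1`, one of `a` and `b` is 0, and that
        -- half sends only `c ≤ 1` edges to its own rest.
        a b c : ℕ
        a = count (link R (rest S))
        b = count (link R′ (rest S))
        c = count (λ e → within G S e ∧ cross G R e)

        split : ∀ a b c {ℓ} {A : Set ℓ} → a + b ≤ 1 → c ≤ 1 → (a + c ≤ 1 → A) → (b + c ≤ 1 → A) → A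
        split zero    b    c _         c≤1 left right = left c≤1
        split (suc a) zero c _         c≤1 left right = right c≤1
        split (suc a) (suc b) c a+b≤1  c≤1 left right = contradiction (ℕ.≤-trans (ℕ.≤-reflexive (sym (ℕ.+-suc a b))) (ℕ.≤-pred a+b≤1)) λ ()

        -- As `R ⊆ S` and `S` avoids `X`, a vertex has only four positions. The three counting
        -- identities hold edge by edge, by evaluation on the sixteen pairs of positions.
        data Kind : Bool → Bool → Bool → Set where
          inR  : Kind true  true  false
          inS  : Kind false true  false
          inX  : Kind false false true
          inW  : Kind false false false

        kind : ∀ r s x → (r ≡ true → s ≡ true) → (s ≡ true → x ≡ false) → Kind r s x
        kind true  true  false p q = inR
        kind false true  false p q = inS
        kind false false true  p q = inX
        kind false false false p q = inW
        kind true  false _     p q = contradiction (sym (p refl)) true≢false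
        kind _     true  true  p q = contradiction (q refl) true≢false

        whole-at : ∀ {r s x r′ s′ x′} → Kind r s x → Kind r′ s′ x′ →
          𝟙 ((s ∧ not (s′ ∨ x′)) ∨ (s′ ∧ not (s ∨ x)))
            ≡ 𝟙 ((r ∧ not (s′ ∨ x′)) ∨ (r′ ∧ not (s ∨ x))) + 𝟙 (((s ∧ not r) ∧ not (s′ ∨ x′)) ∨ ((s′ ∧ not r′) ∧ not (s ∨ x)))
        part₁-at : ∀ {r s x r′ s′ x′} → Kind r s x → Kind r′ s′ x′ →
          𝟙 ((r ∧ not (r′ ∨ x′)) ∨ (r′ ∧ not (r ∨ x)))
            ≡ 𝟙 ((r ∧ not (s′ ∨ x′)) ∨ (r′ ∧ not (s ∨ x))) + 𝟙 ((s ∧ s′) ∧ (r xor r′))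
        part₂-at : ∀ {r s x r′ s′ x′} → Kind r s x → Kind r′ s′ x′ →
          𝟙 (((s ∧ not r) ∧ not ((s′ ∧ not r′) ∨ x′)) ∨ ((s′ ∧ not r′) ∧ not ((s ∧ not r) ∨ x)))
            ≡ 𝟙 (((s ∧ not r) ∧ not (s′ ∨ x′)) ∨ ((s′ ∧ not r′) ∧ not (s ∨ x))) + 𝟙 ((s ∧ s′) ∧ (r xor r′))

        kind-at : ∀ v → Kind (R v) (S v) (X v)
        kind-at v = kind (R v) (S v) (X v) (R⊆S v) (S∩X v)

        whole : count (into S) ≡ a + b
        whole = count-+ (into S) (link R (rest S)) (link R′ (rest S)) λ e → whole-at (kind-at (src G e)) (kind-at (tgt G e))
        part₁ : count (into R) ≡ a + c
        part₁ = count-+ (into R) (link R (rest S)) _ λ e → part₁-at (kind-at (src G e)) (kind-at (tgt G e))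
        part₂ : count (into R′) ≡ b + c
        part₂ = count-+ (into R′) (link R′ (rest S)) _ λ e → part₂-at (kind-at (src G e)) (kind-at (tgt G e))

        whole-at inR inR = refl
        whole-at inR inS = refl
        whole-at inR inX = refl
        whole-at inR inW = refl
        whole-at inS inR = refl
        whole-at inS inS = refl
        whole-at inS inX = refl
        whole-at inS inW = refl
        whole-at inX inR = refl
        whole-at inX inS = refl
        whole-at inX inX = refl
        whole-at inX inW = refl
        whole-at inW inR = refl
        whole-at inW inS = refl
        whole-at inW inX = refl
        whole-at inW inW = refl
        part₁-at inR inR = refl
        part₁-at inR inS = refl
        part₁-at inR inX = refl
        part₁-at inR inW = refl
        part₁-at inS inR = refl
        part₁-at inS inS = refl
        part₁-at inS inX = refl
        part₁-at inS inW = refl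
        part₁-at inX inR = refl
        part₁-at inX inS = refl
        part₁-at inX inX = refl
        part₁-at inX inW = refl
        part₁-at inW inR = refl
        part₁-at inW inS = refl
        part₁-at inW inX = refl
        part₁-at inW inW = refl
        part₂-at inR inR = refl
        part₂-at inR inS = refl
        part₂-at inR inX = refl
        part₂-at inR inW = refl
        part₂-at inS inR = refl
        part₂-at inS inS = refl
        part₂-at inS inX = refl
        part₂-at inS inW = refl
        part₂-at inX inR = refl
        part₂-at inX inS = refl
        part₂-at inX inX = refl
        part₂-at inX inW = refl
        part₂-at inW inR = refl
        part₂-at inW inS = refl
        part₂-at inW inX = refl
        part₂-at inW inW = refl

    -- Sets grow forwards while flows are built backwards, so each growth step carries the map that
    -- undoes it.
    Extension : Set
    Extension = ∃ λ Y → (∀ u → X u ≡ true → Y u ≡ true) × (∃ λ u → X u ≡ false × Y u ≡ true) × (Partial Y → Partial X)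

    -- No edge leaves `S`, so adding `S` to a side changes no pairing, but it flips the side at `v`
    -- and fixes it on `X`. Hence every side constant on `X` may be taken constant on `X ⊹ v`. Edges
    -- inside `X ⊹ v` were loops and can take the value 1 in `f₂`.
    isolated : ∀ S v → S v ≡ true → (∀ v → S v ≡ true → X v ≡ false) → (∀ e → cross G S e ≡ false) →
               Partial (X ⊹ v) → Partial X
    isolated S v Sv S∩X none P = record
      { f₁ = f₁ ; f₂ = g₂ ; f₃ = f₃
      ; even₁ = even₁
      ; even₂ = λ T cX → drop g₂ (refill fill even₂) T cX
      ; even₃ = drop f₃ even₃
      ; vanish = λ e touch → vanish e (touches-mono X (X ⊹ v) (λ _ → ∨-trueˡ _) e touch)
      ; nonzero = λ e _ → case e (within G (X ⊹ v) e) refl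
      }
      where
      open Partial P
      g₂ : Fin m → Bool
      g₂ e = f₂ e ∨ within G (X ⊹ v) e
      fill : ∀ e → within G (X ⊹ v) e ≡ false → g₂ e ≡ f₂ e
      fill e eq = trans (cong (f₂ e ∨_) eq) (Bool.∨-identityʳ _)
      case : ∀ e b → within G (X ⊹ v) e ≡ b → f₁ e ∨ g₂ e ∨ f₃ e ≡ true
      case e true  eq = ∨-trueʳ (f₁ e) (∨-trueˡ _ (∨-trueʳ (f₂ e) eq))
      case e false eq = trans (cong (λ b → f₁ e ∨ b ∨ f₃ e) (fill e eq)) (nonzero e eq)
      drop : ∀ φ → (∀ T → Const (X ⊹ v) T → _⟂_ G φ T) → ∀ T → Const X T → _⟂_ G φ T
      drop φ φ⟂ T cX with any? (λ x → X x Bool.≟ true ×-dec ¬? (T x Bool.≟ T v))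
      ... | no same = φ⟂ T λ x y Xx Xy → trans (to-v x Xx) (sym (to-v y Xy))
        where
        to-v : ∀ x → (X ⊹ v) x ≡ true → T x ≡ T v
        to-v x Xx with ⊹-cases X v Xx
        ... | inj₁ Xx′  = Dec.decidable-stable (T x Bool.≟ T v) λ ≢ → same (x , Xx′ , ≢)
        ... | inj₂ refl = refl
      ... | yes (x , Xx , Tx≢Tv) = begin
        pair G φ T                          ≡⟨ Bool.xor-identityʳ _ ⟨
        pair G φ T xor false                ≡⟨ cong (pair G φ T xor_) (⟂-no-edges G φ S none) ⟨
        pair G φ T xor pair G φ S           ≡⟨ pair-⊻ G φ T S ⟨
        pair G φ (T ⊻ S)                    ≡⟨ φ⟂ (T ⊻ S) (Const-⊹ x v Xx (Const-⊻ cX (Const-outside S X∩S)) (merge (T x) (T v) Tx≢Tv (X∩S x Xx) Sv)) ⟩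
        false                               ∎
        where
        open ≡-Reasoning
        X∩S : ∀ u → X u ≡ true → S u ≡ false
        X∩S u Xu = Bool.¬-not λ Su → contradiction (trans (sym Xu) (S∩X u Su)) true≢false
        merge : ∀ s t {a b} → s ≢ t → a ≡ false → b ≡ true → s xor a ≡ t xor b
        merge true  true  s≢t _ _ = contradiction refl s≢t
        merge false false s≢t _ _ = contradiction refl s≢t
        merge true  false s≢t refl refl = refl
        merge false true  s≢t refl refl = refl

    -- All edges inside Y = X ∪ U start with the value (1 , 1) in (f₂ , f₃); e₂ then takes the value
    -- forced by the cut around U, and e₁ is lowered to (1 , 0) when that value would be (0 , 0).
    -- Finally f₂ and f₃ are lifted along the edges of C inside U, where f₁ becomes 1.
    attach : ∀ U C e₁ e₂ b₁ x₁ b₂ x₂ →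
             (∀ v → U v ≡ true → X v ≡ false) → LiftsAlong G X U C → (∀ e → C e ≡ true → cross G U e ≡ false) →
             (∀ S → _⟂_ G C S) → e₁ ≢ e₂ →
             U b₁ ≡ true → X x₁ ≡ true → (∀ S → cross G S e₁ ≡ S b₁ xor S x₁) → (∀ S → within G S e₁ ≡ S b₁ ∧ S x₁) →
             U b₂ ≡ true → X x₂ ≡ true → (∀ S → cross G S e₂ ≡ S b₂ xor S x₂) → (∀ S → within G S e₂ ≡ S b₂ ∧ S x₂) →
             Partial (X ∪ₛ U) → Partial X
    attach U C e₁ e₂ b₁ x₁ b₂ x₂ U∩X lifts closed C⟂ e₁≢e₂ Ub₁ Xx₁ cross₁ within₁ Ub₂ Xx₂ cross₂ within₂ P = record
      { f₁ = λ e → f₁ e xor C″ e ; f₂ = proj₁ lifted₂ ; f₃ = proj₁ lifted₃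
      ; even₁ = λ S → trans (pair-xor G f₁ C″ S) (cong₂ _xor_ (even₁ S) (C″⟂ S))
      ; even₂ = proj₂ (proj₂ lifted₂)
      ; even₃ = proj₂ (proj₂ lifted₃)
      ; vanish = λ e touch → cong₂ _xor_ (vanish e (touches-mono X Y (λ _ → ∨-trueˡ _) e touch))
          (Bool.¬-not λ C″e → avoid e touch (proj₂ (true∧ {C e} C″e)))
      ; nonzero = λ e _ → case e (within G Y e) refl (C″ e) refl
      }
      where
      open Partial P
      Y : Side n
      Y = X ∪ₛ U
      C″ g₂ g₃⁰ g₃ r₂ r₃ : Fin m → Bool
      C″ e = C e ∧ within G U e
      g₂ e = f₂ e ∨ within G Y e
      g₃⁰ e = f₃ e ∨ within G Y e
      -- The totals over the cut of `U` while `e₂` still has the value (1 , 1). Repairing them there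
      -- would give `e₂` the value (1 + `h₂` , 1 + `h₃`), which is zero only for `h₂` = `h₃` = 1;
      -- hence the correction `h₂ ∧ h₃` at `e₁`.
      h₂ h₃ : Bool
      h₂ = pair G g₂ U
      h₃ = pair G g₃⁰ U
      g₃ e = g₃⁰ e xor ((e == e₁) ∧ (h₂ ∧ h₃))
      r₂ = repair G g₂ U e₂
      r₃ = repair G g₃ U e₂

      X∩U : ∀ u → X u ≡ true → U u ≡ false
      X∩U u Xu = Bool.¬-not λ Uu → contradiction (trans (sym Xu) (U∩X u Uu)) true≢false

      avoid : ∀ e → touches X e ≡ true → within G U e ≢ true
      avoid e touch Ue with Us , Ut ← true∧ {U (src G e)} Ue with true∨ {X (src G e)} touch
      ... | inj₁ Xs = contradiction (trans (sym Xs) (U∩X _ Us)) true≢false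
      ... | inj₂ Xt = contradiction (trans (sym Xt) (U∩X _ Ut)) true≢false

      -- No edge of `C` leaves `U`, so pairing the part inside `U` with `S` is pairing all of `C`
      -- with the intersection of `U` and `S`.
      C″⟂ : ∀ S → _⟂_ G C″ S
      C″⟂ S = trans (⊕.sum-cong-≗ λ e → restrict (C e) (U (src G e)) (U (tgt G e)) (S (src G e)) (S (tgt G e)) (closed e))
                    (C⟂ λ v → U v ∧ S v)
        where
        restrict : ∀ c u u′ s s′ → (c ≡ true → u xor u′ ≡ false) → (c ∧ (u ∧ u′)) ∧ (s xor s′) ≡ c ∧ ((u ∧ s) xor (u′ ∧ s′))
        restrict false u     u′    s s′ h = refl
        restrict true  true  true  s s′ h = refl
        restrict true  false false s s′ h = refl
        restrict true  true  false s s′ h = contradiction (h refl) true≢false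
        restrict true  false true  s s′ h = contradiction (h refl) true≢false

      Y₁ : within G Y e₁ ≡ true
      Y₁ = trans (within₁ Y) (∧-true (∨-trueʳ _ Ub₁) (∨-trueˡ _ Xx₁))
      Y₂ : within G Y e₂ ≡ true
      Y₂ = trans (within₂ Y) (∧-true (∨-trueʳ _ Ub₂) (∨-trueˡ _ Xx₂))

      outside-≢ : ∀ {e e′} → within G Y e′ ≡ true → within G Y e ≡ false → e ≢ e′
      outside-≢ Ye′ Ye refl = contradiction (trans (sym Ye′) Ye) true≢false

      fill₂ : ∀ e → within G Y e ≡ false → g₂ e ≡ f₂ e
      fill₂ e eq = trans (cong (f₂ e ∨_) eq) (Bool.∨-identityʳ _)
      fill₃ : ∀ e → within G Y e ≡ false → g₃ e ≡ f₃ e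
      fill₃ e eq = trans (cong₂ _xor_ (trans (cong (f₃ e ∨_) eq) (Bool.∨-identityʳ _)) (cong (_∧ (h₂ ∧ h₃)) (==-≢ (outside-≢ Y₁ eq))))
                         (Bool.xor-identityʳ _)

      Const-∪ : ∀ S → Const X S → Const U S → S b₂ ≡ S x₂ → Const Y S
      Const-∪ S cX cU eq u v Yu Yv = trans (to-x u Yu) (sym (to-x v Yv))
        where
        to-x : ∀ u → Y u ≡ true → S u ≡ S x₂
        to-x u Yu with true∨ {X u} Yu
        ... | inj₁ Xu = cX u x₂ Xu Xx₂
        ... | inj₂ Uu = trans (cU u b₂ Uu Ub₂) eq

      merge : ∀ s t {a b} → s xor t ≡ true → a ≡ true → b ≡ false → s xor a ≡ t xor b
      merge true  false _ refl refl = refl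
      merge false true  _ refl refl = refl

      -- Splits the class `Y` into the two classes `X` and `U`, both still identified. As in
      -- `repair-⊹`, `e₂` stops being a loop and takes up the defect, here that of the cut around
      -- `U`.
      join : ∀ φ → (∀ S → Const Y S → _⟂_ G φ S) → ∀ S → Const X S → Const U S → _⟂_ G (repair G φ U e₂) S
      join φ φ⟂ S cX cU = repair-⟂ G φ U e₂ S (trans (cross₂ U) (cong₂ _xor_ Ub₂ (X∩U x₂ Xx₂)))
        (λ Se → φ⟂ S (Const-∪ S cX cU (xor-false (trans (sym (cross₂ S)) Se))))
        (λ Se → φ⟂ (S ⊻ U) (Const-∪ (S ⊻ U) (Const-⊻ cX (Const-outside U X∩U)) (Const-⊻ cU λ u v Uu Uv → trans Uu (sym Uv))
          (merge (S b₂) (S x₂) (trans (sym (cross₂ S)) Se) Ub₂ (X∩U x₂ Xx₂))))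

      lifted₂ = lifts r₂ (join g₂ (refill fill₂ even₂))
      lifted₃ = lifts r₃ (join g₃ (refill fill₃ even₃))

      pair₃ : pair G g₃ U ≡ h₃ xor (h₂ ∧ h₃)
      pair₃ = trans (pair-xor G g₃⁰ _ U) (cong (h₃ xor_) (trans (pair-point G e₁ (h₂ ∧ h₃) U)
        (trans (cong ((h₂ ∧ h₃) ∧_) (trans (cross₁ U) (cong₂ _xor_ Ub₁ (X∩U x₁ Xx₁)))) (Bool.∧-identityʳ _))))

      r₂-at : r₂ e₂ ≡ not h₂
      r₂-at = trans (repair-≡ G g₂ U e₂) (cong (_xor h₂) (∨-trueʳ (f₂ e₂) Y₂))
      r₃-at : r₃ e₂ ≡ not (h₃ xor (h₂ ∧ h₃))
      r₃-at = trans (repair-≡ G g₃ U e₂) (cong₂ _xor_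
        (cong₂ _xor_ (∨-trueʳ (f₃ e₂) Y₂) (cong (_∧ (h₂ ∧ h₃)) (==-≢ (e₁≢e₂ ∘ sym)))) pair₃)

      case : ∀ e b → within G Y e ≡ b → ∀ c → C″ e ≡ c → (f₁ e xor C″ e) ∨ proj₁ lifted₂ e ∨ proj₁ lifted₃ e ≡ true
      case e false eq c _ = trans (cong₂ _∨_ (trans (cong (f₁ e xor_) ¬C″) (Bool.xor-identityʳ (f₁ e)))
          (cong₂ _∨_ (trans (proj₁ (proj₂ lifted₂) e ¬C″) (trans (repair-≢ G g₂ U (outside-≢ Y₂ eq)) (fill₂ e eq)))
                     (trans (proj₁ (proj₂ lifted₃) e ¬C″) (trans (repair-≢ G g₃ U (outside-≢ Y₂ eq)) (fill₃ e eq)))))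
        (nonzero e eq)
        where
        ¬C″ : C″ e ≡ false
        ¬C″ = Bool.¬-not λ C″e → contradiction (trans (sym (within-mono G U Y (λ u → ∨-trueʳ (X u)) e (proj₂ (true∧ {C e} C″e)))) eq) true≢false
      case e true eq true C″e = ∨-trueˡ _ (cong₂ _xor_ (vanish e (∨-trueˡ _ (proj₁ (true∧ {Y (src G e)} eq)))) C″e)
      case e true eq false C″e with e ≟ e₂
      ... | no e≢e₂ = ∨-trueʳ (f₁ e xor C″ e) (∨-trueˡ _
              (trans (proj₁ (proj₂ lifted₂) e C″e) (trans (repair-≢ G g₂ U e≢e₂) (∨-trueʳ (f₂ e) eq))))
      ... | yes refl = ∨-trueʳ (f₁ e xor C″ e) (trans (cong₂ _∨_ (trans (proj₁ (proj₂ lifted₂) e C″e) r₂-at)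
              (trans (proj₁ (proj₂ lifted₃) e C″e) r₃-at)) (one-survives h₂ h₃))
        where
        one-survives : ∀ h₂ h₃ → not h₂ ∨ not (h₃ xor (h₂ ∧ h₃)) ≡ true
        one-survives false h₃    = refl
        one-survives true  false = refl
        one-survives true  true  = refl

    extend : (∀ S → count (cross G S) ≢ 1) → (∀ S → count (cross G S) ≢ 2) → ∀ v → X v ≡ false →
             Extension
    extend no-1 no-2 v Xv = build (smallest candidate? candidate-≗ (not ∘ X) start)
      where
      start : Candidate (not ∘ X)
      start = (v , cong not Xv) , (λ _ → not-true) ,
        subst (_≤ 1) (sym (count-none _ λ e → empty (X (src G e)) (X (tgt G e)))) z≤n
        where
        empty : ∀ x y → (not x ∧ not (not y ∨ y)) ∨ (not y ∧ not (not x ∨ x)) ≡ false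
        empty true  true  = refl
        empty true  false = refl
        empty false true  = refl
        empty false false = refl

      build : (∃ λ S → Candidate S × (∀ S′ → count S′ < count S → ¬ Candidate S′)) → Extension
      build (S , ((s , Ss) , S∩X , few) , least) = case (count (cross G S)) refl
        where
        case : ∀ d → count (cross G S) ≡ d →
               Extension
        case zero d≡ = X ⊹ s , (λ u → ∨-trueˡ _) , (s , S∩X s Ss , ⊹-new X s) , isolated S s Ss S∩X (count≡0 (cross G S) d≡)
        case (suc zero) d≡ = contradiction d≡ (no-1 S)
        case (suc (suc zero)) d≡ = contradiction d≡ (no-2 S)
        case (suc (suc (suc d))) d≡ = two-edges (count-two (link S X) many)
          where
          -- Of at least three edges leaving `S` at most one goes to the rest, so two go to `X`. In
          -- particular this case cannot arise for empty `X`.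
          many : 2 ≤ count (link S X)
          many = ℕ.+-cancelʳ-≤ 1 2 _ (ℕ.≤-trans (s≤s (s≤s (s≤s z≤n)))
            (ℕ.≤-trans (ℕ.≤-reflexive (trans (sym d≡) (boundary S S∩X))) (ℕ.+-monoʳ-≤ (count (link S X)) few)))

          End : Fin m → Set
          End e = ∃₂ λ b x → S b ≡ true × X x ≡ true ×
            (∀ T → cross G T e ≡ T b xor T x) × (∀ T → within G T e ≡ T b ∧ T x)

          through : ∀ e₁ e₂ → e₁ ≢ e₂ → End e₁ → End e₂ → Extension
          -- The ends `b₁` and `b₂` may coincide: then no `R` separates them and the cut condition
          -- is vacuous.
          through e₁ e₂ e₁≢e₂ (b₁ , x₁ , Sb₁ , Xx₁ , cross₁ , within₁) (b₂ , x₂ , Sb₂ , Xx₂ , cross₂ , within₂) =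
            trail (evenThrough G S b₁ b₂ Sb₁ λ R R⊆S Rb₁ Rb₂ → inner-cuts S S∩X few least R R⊆S b₁ b₂ Rb₁ Sb₂ Rb₂)
            where
            trail : (∃ λ (C : Fin m → Bool) → (∀ e → C e ≡ true → within G S e ≡ true) × (∀ T → _⟂_ G C T) ×
                      (∀ T → T b₁ ≡ true → T b₂ ≡ false → ∃ λ e → C e ≡ true × cross G T e ≡ true)) → Extension
            trail (C , C⊆S , C⟂ , meets) = merge (component G X S C C⊆S S∩X b₁ Sb₁)
              where
              merge : (∃ λ U → U b₁ ≡ true × (∀ v → U v ≡ true → S v ≡ true) × LiftsAlong G X U C ×
                        (∀ e → C e ≡ true → cross G U e ≡ false)) → Extension
              merge (U , Ub₁ , U⊆S , lifts , closed) =
                X ∪ₛ U , (λ u → ∨-trueˡ _) , (b₁ , S∩X b₁ Sb₁ , ∨-trueʳ _ Ub₁) ,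
                attach U C e₁ e₂ b₁ x₁ b₂ x₂ (λ v → S∩X v ∘ U⊆S v) lifts closed C⟂ e₁≢e₂ Ub₁ Xx₁ cross₁ within₁ Ub₂ Xx₂ cross₂ within₂
                where
                Ub₂ : U b₂ ≡ true
                Ub₂ = Dec.decidable-stable (U b₂ Bool.≟ true) λ ¬Ub₂ →
                  let e , Ce , Ue = meets U Ub₁ (Bool.¬-not ¬Ub₂) in contradiction (trans (sym Ue) (closed e Ce)) true≢false

          two-edges : (∃₂ λ e₁ e₂ → e₁ ≢ e₂ × link S X e₁ ≡ true × link S X e₂ ≡ true) → Extension
          two-edges (e₁ , e₂ , e₁≢e₂ , l₁ , l₂) = through e₁ e₂ e₁≢e₂ (link-ends S X e₁ l₁) (link-ends S X e₂ l₂)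

  -- For the empty set `Const` is no restriction and no edge lies inside, so a `Partial` is a
  -- nowhere-zero flow over F₂³. The induction starts from the whole vertex set, where every edge is
  -- a loop and zero flows serve.
  cover : (∀ S → count (cross G S) ≢ 1) → (∀ S → count (cross G S) ≢ 2) → Partial (λ _ → false)
  cover no-1 no-2 = go (size-co {n} (λ _ → false)) (λ _ → false) ℕ.≤-refl
    where
    everything : ∀ X → (∀ v → X v ≡ true) → Partial X
    everything X X-all = record
      { f₁ = λ _ → false ; f₂ = λ _ → false ; f₃ = λ _ → false
      ; even₁ = zero-⟂ ; even₂ = λ S _ → zero-⟂ S ; even₃ = λ S _ → zero-⟂ S
      ; vanish = λ _ _ → refl
      ; nonzero = λ e eq → contradiction (trans (sym (∧-true (X-all (src G e)) (X-all (tgt G e)))) eq) true≢false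
      }

    go : ∀ fuel X → size-co X ≤ fuel → Partial X
    advance : ∀ fuel X → size-co X ≤ fuel → Extension X → Partial X
    advance zero X ≤fuel (Y , X⊆Y , (u , Xu , Yu) , back) =
      contradiction (ℕ.≤-trans (size-co-< X Y X⊆Y u Xu Yu) ≤fuel) λ ()
    advance (suc fuel) X ≤fuel (Y , X⊆Y , (u , Xu , Yu) , back) =
      back (go fuel Y (ℕ.≤-pred (ℕ.≤-trans (size-co-< X Y X⊆Y u Xu Yu) ≤fuel)))
    go fuel X ≤fuel = decide (any? λ v → X v Bool.≟ false)
      where
      decide : Dec (∃ λ v → X v ≡ false) → Partial X
      decide (yes (v , Xv)) = advance fuel X ≤fuel (extend X no-1 no-2 v Xv)
      decide (no none)      = everything X λ v → Bool.¬-not (none ∘ (v ,_))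

-- Contracting an edge of a small cut

CutEdge : ∀ {n m} → Multigraph n m → Fin m → Set
CutEdge G e = ∃ λ S → cross G S e ≡ true × (∀ i → i ≢ e → cross G S i ≡ false)

record EightFlow {n m} (G : Multigraph n m) : Set where
  field
    f₁ f₂ f₃ : Fin m → Bool
    even₁    : ∀ S → _⟂_ G f₁ S
    even₂    : ∀ S → _⟂_ G f₂ S
    even₃    : ∀ S → _⟂_ G f₃ S
    nonzero  : ∀ e → f₁ e ∨ f₂ e ∨ f₃ e ≡ true ⊎ CutEdge G e

nonloop : ∀ {n m} → Multigraph n m → Fin m → Bool
nonloop G e = not (src G e == tgt G e)

redirect : ∀ {n} → Fin n → Fin n → Fin n → Fin n
redirect a b v = if v == b then a else v

-- Vertex and edge indices are kept: `tgt G e` stays behind without edges when `e` is not a loop,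
-- and `e` becomes a loop. Flows thus pass between the two graphs unchanged off `e`, and the number
-- of nonloops is the measure that drops.
contract : ∀ {n m} → Multigraph n m → Fin m → Multigraph n m
contract G e = record
  { src = redirect (src G e) (tgt G e) ∘ src G
  ; tgt = redirect (src G e) (tgt G e) ∘ tgt G
  }

redirect-invariant : ∀ {n} (S : Side n) a b → S a ≡ S b → S ∘ redirect a b ≗ S
redirect-invariant S a b eq v with v ≟ b
... | yes refl = eq
... | no  _    = refl

contract-nonloop : ∀ {n m} (G : Multigraph n m) e → nonloop G e ≡ true →
                   count (nonloop (contract G e)) < count (nonloop G)
contract-nonloop G e e-nonloop = count-strict (nonloop (contract G e)) (nonloop G)
  (λ i eq → keep i eq) e e-nonloop (cong not (trans (cong₂ _==_ src≡ tgt≡) (==-refl (src G e))))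
  where
  keep : ∀ i → nonloop (contract G e) i ≡ true → nonloop G i ≡ true
  keep i eq with src G i ≟ tgt G i
  ... | no  _ = refl
  ... | yes loop = contradiction (trans (sym eq) (cong not (loop-stays (src G i) (tgt G i) loop))) true≢false
    where
    loop-stays : ∀ u v → u ≡ v → (redirect (src G e) (tgt G e) u == redirect (src G e) (tgt G e) v) ≡ true
    loop-stays u _ refl = ==-refl (redirect (src G e) (tgt G e) u)
  src≡ : redirect (src G e) (tgt G e) (src G e) ≡ src G e
  src≡ = cong (λ b → if b then src G e else src G e) (not-true e-nonloop)
  tgt≡ : redirect (src G e) (tgt G e) (tgt G e) ≡ src G e
  tgt≡ = cong (λ b → if b then src G e else tgt G e) (==-refl (tgt G e))

module _ {n m} (G : Multigraph n m) (e : Fin m) (e-nonloop : nonloop G e ≡ true) where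

  uncontract : (Fin m → Bool) → Fin m → Bool
  uncontract φ = repair G φ ⁅ tgt G e ⁆ e

  -- Uncontracting releases `tgt G e` from a class of two vertices, with no other set identified.
  uncontract-⟂ : ∀ φ → (∀ S → _⟂_ (contract G e) φ S) → ∀ S → _⟂_ G (uncontract φ) S
  uncontract-⟂ φ φ⟂ S = repair-⊹ G φ {⁅ src G e ⁆} {λ _ → false} e (==-refl (src G e))
    (trans (does-sym (tgt G e) (src G e)) (not-true e-nonloop)) refl (λ T → refl)
    (λ T _ cT → ⟂-≗ G φ (redirect-invariant T (src G e) (tgt G e)
       (cT _ _ (∨-trueˡ _ (==-refl (src G e))) (⊹-new ⁅ src G e ⁆ (tgt G e)))) (φ⟂ T))
    S (λ _ _ ()) λ u v eu ev → cong S (trans (==-sound eu) (sym (==-sound ev)))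
    where
    does-sym : ∀ {n} (i j : Fin n) → (i == j) ≡ (j == i)
    does-sym i j with i ≟ j | j ≟ i
    ... | yes _   | yes _   = refl
    ... | no  _   | no  _   = refl
    ... | yes i≡j | no  j≢i = contradiction (sym i≡j) j≢i
    ... | no  i≢j | yes j≡i = contradiction (sym j≡i) i≢j

  uncontract-cutEdge : ∀ {i} → CutEdge (contract G e) i → CutEdge G i
  uncontract-cutEdge (S , Si , others) = S ∘ redirect (src G e) (tgt G e) , Si , others

  uncontract-flow : (F : EightFlow (contract G e)) → let open EightFlow F in
    (uncontract f₁ e ∨ uncontract f₂ e ∨ uncontract f₃ e ≡ true ⊎ CutEdge G e) → EightFlow G
  uncontract-flow F at-e = record
    { f₁ = uncontract f₁ ; f₂ = uncontract f₂ ; f₃ = uncontract f₃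
    ; even₁ = uncontract-⟂ f₁ even₁ ; even₂ = uncontract-⟂ f₂ even₂ ; even₃ = uncontract-⟂ f₃ even₃
    ; nonzero = good
    }
    where
    open EightFlow F
    Good : Fin m → Set
    Good i = uncontract f₁ i ∨ uncontract f₂ i ∨ uncontract f₃ i ≡ true ⊎ CutEdge G i
    good : ∀ i → Good i
    good i = [ (λ i≡e → subst Good (sym i≡e) at-e) , elsewhere ]′ (toSum (i ≟ e))
      where
      off : i ≢ e → ∀ φ → uncontract φ i ≡ φ i
      off i≢e φ = repair-≢ G φ ⁅ tgt G e ⁆ i≢e
      elsewhere : i ≢ e → Good i
      elsewhere i≢e = [ (λ nz → inj₁ (trans (cong₂ _∨_ (off i≢e f₁) (cong₂ _∨_ (off i≢e f₂) (off i≢e f₃))) nz)) ,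
                        inj₂ ∘ uncontract-cutEdge ]′ (nonzero i)

cross⇒nonloop : ∀ {n m} (G : Multigraph n m) S e → cross G S e ≡ true → nonloop G e ≡ true
cross⇒nonloop G S e Se with src G e ≟ tgt G e
... | no _ = refl
... | yes loop = contradiction (trans (sym Se) (xor-≡ (cong S loop))) true≢false

two-edge-cut : ∀ {n m} (G : Multigraph n m) φ S {e e′} → cross G S e ≡ true → cross G S e′ ≡ true → e ≢ e′ →
               (∀ i → i ≢ e → i ≢ e′ → cross G S i ≡ false) → _⟂_ G φ S → φ e ≡ φ e′
two-edge-cut {m = m} G φ S {e} {e′} Se Se′ e≢e′ others φ⟂ = xor-false (begin
  φ e xor φ e′                          ≡⟨ cong₂ _xor_ (point Se) (point Se′) ⟨
  part e e xor part e′ e′               ≡⟨ cong₂ _xor_ (total e) (total e′) ⟨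
  ⨁ (part e) xor ⨁ (part e′)            ≡⟨ ⊕.∑-distrib-+ (part e) (part e′) ⟨
  ⨁ (λ i → part e i xor part e′ i)      ≡⟨ ⊕.sum-cong-≗ split ⟨
  pair G φ S                            ≡⟨ φ⟂ ⟩
  false                                 ∎)
  where
  open ≡-Reasoning
  part : Fin m → Fin m → Bool
  part e i = (i == e) ∧ (φ i ∧ cross G S i)
  point : ∀ {e} → cross G S e ≡ true → part e e ≡ φ e
  point {e} Se = trans (cong₂ _∧_ (==-refl e) (cong (φ e ∧_) Se)) (Bool.∧-identityʳ (φ e))
  total : ∀ e → ⨁ (part e) ≡ part e e
  total e = sum-point xor-commutativeMonoid (part e) e λ i i≢e → cong (_∧ (φ i ∧ cross G S i)) (==-≢ i≢e)
  split : ∀ i → φ i ∧ cross G S i ≡ part e i xor part e′ i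
  split i with i ≟ e | i ≟ e′
  ... | yes p | yes q = contradiction (trans (sym p) q) e≢e′
  ... | yes p | no  _ = sym (Bool.xor-identityʳ _)
  ... | no  _ | yes q = refl
  ... | no  p | no  q = trans (cong (φ i ∧_) (others i p q)) (Bool.∧-zeroʳ (φ i))

-- Jaeger's eight-flow theorem
eightFlow : ∀ {n m} (G : Multigraph n m) → EightFlow G
eightFlow {n} {m} G = go (count (nonloop G)) G ℕ.≤-refl
  where
  count-cross-≗ : ∀ (G : Multigraph n m) c {S S′} → S ≗ S′ → count (cross G S) ≡ c → count (cross G S′) ≡ c
  count-cross-≗ G c S≗ eq = trans (Σℕ.sum-cong-≗ λ e → cong 𝟙 (sym (cross-≗ G S≗ e))) eq

  go : ∀ fuel (G : Multigraph n m) → count (nonloop G) ≤ fuel → EightFlow G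
  reduce : ∀ fuel (G : Multigraph n m) → count (nonloop G) ≤ fuel → ∀ e → nonloop G e ≡ true → EightFlow (contract G e)
  reduce zero G ≤fuel e e-nonloop = contradiction (ℕ.≤-trans (contract-nonloop G e e-nonloop) ≤fuel) λ ()
  reduce (suc fuel) G ≤fuel e e-nonloop = go fuel (contract G e) (ℕ.≤-pred (ℕ.≤-trans (contract-nonloop G e e-nonloop) ≤fuel))

  go fuel G ≤fuel = one (anySide? (λ S → count (cross G S) ℕ.≟ 1) (count-cross-≗ G 1))
    where
    one : Dec (∃ λ S → count (cross G S) ≡ 1) → EightFlow G
    two : ¬ (∃ λ S → count (cross G S) ≡ 1) → Dec (∃ λ S → count (cross G S) ≡ 2) → EightFlow G
    one (yes (S , d≡1)) = contract-bridge (count≡1 (cross G S) d≡1)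
      where
      contract-bridge : (∃ λ e → cross G S e ≡ true × (∀ i → i ≢ e → cross G S i ≡ false)) → EightFlow G
      contract-bridge (e , Se , others) =
        uncontract-flow G e (cross⇒nonloop G S e Se) (reduce fuel G ≤fuel e (cross⇒nonloop G S e Se)) (inj₂ (S , Se , others))
    one (no no-1) = two no-1 (anySide? (λ S → count (cross G S) ℕ.≟ 2) (count-cross-≗ G 2))
    two no-1 (no no-2) = record { Partial P hiding (even₂; even₃; vanish; nonzero)
      ; even₂ = λ S → Partial.even₂ P S λ _ _ ()
      ; even₃ = λ S → Partial.even₃ P S λ _ _ ()
      ; nonzero = λ e → inj₁ (Partial.nonzero P e refl)
      }
      where
      P : Partial G (λ _ → false)
      P = cover G (λ S eq → no-1 (S , eq)) (λ S eq → no-2 (S , eq))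
    two no-1 (yes (S , d≡2)) = contract-pair (count≡2 (cross G S) d≡2)
      where
      contract-pair : (∃₂ λ e e′ → e ≢ e′ × cross G S e ≡ true × cross G S e′ ≡ true ×
                        (∀ i → i ≢ e → i ≢ e′ → cross G S i ≡ false)) → EightFlow G
      contract-pair (e , e′ , e≢e′ , Se , Se′ , others) = uncontract-flow G e e-nonloop F at-e
        where
        e-nonloop : nonloop G e ≡ true
        e-nonloop = cross⇒nonloop G S e Se
        F : EightFlow (contract G e)
        F = reduce fuel G ≤fuel e e-nonloop
        open EightFlow F
        -- The two edges of the cut must carry equal values, so `e` is nonzero whenever `e′` is
        -- nonzero in the contraction.
        same : ∀ φ → (∀ S → _⟂_ (contract G e) φ S) → uncontract G e e-nonloop φ e ≡ φ e′
        same φ φ⟂ = trans (two-edge-cut G _ S Se Se′ e≢e′ others (uncontract-⟂ G e e-nonloop φ φ⟂ S)) (repair-≢ G φ ⁅ tgt G e ⁆ (e≢e′ ∘ sym))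
        -- If `D` is crossed by `e′` alone, adding it to the cut of `e` and `e′` leaves `e` alone.
        transfer : CutEdge (contract G e) e′ → CutEdge G e
        transfer cut with D , De′ , D-others ← uncontract-cutEdge G e e-nonloop cut =
          S ⊻ D , trans (⊻-cross e) (cong₂ _xor_ Se (D-others e e≢e′)) , off
          where
          ⊻-cross : ∀ i → cross G (S ⊻ D) i ≡ cross G S i xor cross G D i
          ⊻-cross i = interchange (S (src G i)) (D (src G i)) (S (tgt G i)) (D (tgt G i))
            where
            open CommutativeSemigroup (CommutativeMonoid.commutativeSemigroup xor-commutativeMonoid) using (interchange)
          off : ∀ i → i ≢ e → cross G (S ⊻ D) i ≡ false
          off i i≢e with i ≟ e′
          ... | yes refl = trans (⊻-cross i) (cong₂ _xor_ Se′ De′)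
          ... | no i≢e′  = trans (⊻-cross i) (cong₂ _xor_ (others i i≢e i≢e′) (D-others i i≢e′))
        at-e : uncontract G e e-nonloop f₁ e ∨ uncontract G e e-nonloop f₂ e ∨ uncontract G e e-nonloop f₃ e ≡ true ⊎ CutEdge G e
        at-e = [ (λ nz → inj₁ (trans (cong₂ _∨_ (same f₁ even₁) (cong₂ _∨_ (same f₂ even₂) (same f₃ even₃))) nz)) , inj₂ ∘ transfer ]′ (nonzero e′)

-- Adjacency in simple graphs

private
  variable
    n : ℕ

≡⇒T : ∀ {b} → b ≡ true → T b
≡⇒T = Equivalence.from T-≡

T⇒≡ : ∀ {b} → T b → b ≡ true
T⇒≡ = Equivalence.to T-≡

Adj? : (G : Graph n) → Decidable (Adj G)
Adj? G u v = T? (adj G u v)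

Adj-sym : (G : Graph n) → ∀ {u v} → Adj G u v → Adj G v u
Adj-sym G {u} {v} = subst T (symm G u v)

Adj⇒≢ : (G : Graph n) → ∀ {u v} → Adj G u v → u ≢ v
Adj⇒≢ G {u} uv refl = subst T (irrefl G u) uv

deleteEdge? : (G : Graph n) → ∀ a b → Decidable (deleteEdge G a b)
deleteEdge? G a b u v = Adj? G u v ×-dec ¬? ((u ≟ a ×-dec v ≟ b) ⊎-dec (u ≟ b ×-dec v ≟ a))

deleteEdge-sym : (G : Graph n) → ∀ a b {u v} → deleteEdge G a b u v → deleteEdge G a b v u
deleteEdge-sym G a b (uv , ≢ab) = Adj-sym G uv ,
  λ { (inj₁ (p , q)) → ≢ab (inj₂ (q , p)) ; (inj₂ (p , q)) → ≢ab (inj₁ (q , p)) }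

-- Reachability

On : Side n → Rel (Fin n) 0ℓ → Rel (Fin n) 0ℓ
On S R u v = S u ≡ true × S v ≡ true × R u v

-- Paths are required to stay inside the reached set, since the branch sets of a minor must be
-- connected in themselves.
record Reach (R : Rel (Fin n) 0ℓ) (a : Fin n) : Set where
  field
    reached : Side n
    base    : reached a ≡ true
    path    : ∀ v → reached v ≡ true → Star (On reached R) a v
    closed  : ∀ {u v} → R u v → reached u ≡ true → reached v ≡ true

  sound : ∀ v → reached v ≡ true → Star R a v
  sound v Rv = Star.map (proj₂ ∘ proj₂) (path v Rv)

  closed* : ∀ {u v} → Star R u v → reached u ≡ true → reached v ≡ true
  closed* ε       Ru = Ru
  closed* (s ◅ p) Ru = closed* p (closed s Ru)

reach : {R : Rel (Fin n) 0ℓ} → Decidable R → ∀ a → Reach R a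
reach {n} {R} R? a with grow {Inv = Inv} {Done = Done} step ⁅ a ⁆ start
  where
  Inv Done : Side n → Set
  Inv S = S a ≡ true × (∀ v → S v ≡ true → Star (On S R) a v)
  Done S = ∀ {u v} → R u v → S u ≡ true → S v ≡ true

  start : Inv ⁅ a ⁆
  start = ==-refl a , λ v eq → subst (Star _ a) (sym (==-sound eq)) ε

  step : ∀ S → Inv S → (∃ λ v → S v ≡ false × Inv (S ⊹ v)) ⊎ Done S
  step S (Sa , paths) with any? (λ u → any? (λ v → S u Bool.≟ true ×-dec S v Bool.≟ false ×-dec R? u v))
  ... | no none = inj₂ λ {u} {v} uv Su → Dec.decidable-stable (S v Bool.≟ true) λ ¬Sv → none (u , v , Su , Bool.¬-not ¬Sv , uv)
  ... | yes (u , v , Su , Sv , uv) = inj₁ (v , Sv , ∨-trueˡ _ Sa , paths′)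
    where
    wider : ∀ {w} → Star (On S R) a w → Star (On (S ⊹ v) R) a w
    wider = Star.map λ (Sx , Sy , xy) → ∨-trueˡ _ Sx , ∨-trueˡ _ Sy , xy
    paths′ : ∀ w → (S ⊹ v) w ≡ true → Star (On (S ⊹ v) R) a w
    paths′ w Sw with ⊹-cases S v Sw
    ... | inj₁ Sw′  = wider (paths w Sw′)
    ... | inj₂ refl = wider (paths u Su) ◅◅ ((∨-trueˡ _ Su , ⊹-new S v , uv) ◅ ε)
... | S , (Sa , paths) , closed = record { reached = S ; base = Sa ; path = paths ; closed = closed }

-- Simple paths

suffix : {R : Rel (Fin n) 0ℓ} → ∀ {u v w} (p : Star R w v) → Unique (vertices p) → u ∈ vertices p →
         Σ (Star R u v) λ q → Unique (vertices q)
suffix ε       uniq       (here refl) = ε , uniq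
suffix (s ◅ p) uniq       (here refl) = s ◅ p , uniq
suffix (s ◅ p) (_ ∷ uniq) (there u∈p) = suffix p uniq u∈p

simplify : {R : Rel (Fin n) 0ℓ} → ∀ {u v} → Star R u v → Σ (Star R u v) λ q → Unique (vertices q)
simplify ε = ε , [] ∷ []
simplify {u = u} (s ◅ p) with q , uniq ← simplify p with _∈?_ _≟_ u (vertices q)
... | yes u∈q = suffix q uniq u∈q
... | no  u∉q = s ◅ q , ¬Any⇒All¬ _ u∉q ∷ uniq

module _ {R R′ : Rel (Fin n) 0ℓ} (f : ∀ {u v} → R u v → R′ u v) where

  vertices-map : ∀ {u v} (p : Star R u v) → vertices (Star.map f p) ≡ vertices p
  vertices-map ε       = refl
  vertices-map (s ◅ p) = cong (_ ∷_) (vertices-map p)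

  len-map : ∀ {u v} (p : Star R u v) → len (Star.map f p) ≡ len p
  len-map ε       = refl
  len-map (s ◅ p) = cong suc (len-map p)

-- A simple path from `a` to `b` that avoids the edge between them has at least two edges, and that
-- edge closes it to a cycle.
acyclic⇒separates : (F : Graph n) → Acyclic F → ∀ {a b} → Adj F a b → ¬ Star (deleteEdge F a b) a b
acyclic⇒separates F acyclic {a} {b} ab walk with p , uniq ← simplify walk =
  acyclic (a , b , Star.map proj₁ p , subst Unique (sym (vertices-map proj₁ p)) uniq ,
           subst (2 ≤_) (sym (len-map proj₁ p)) (long p (Adj⇒≢ F ab)) , Adj-sym F ab)
  where
  long : (p : Star (deleteEdge F a b) a b) → a ≢ b → 2 ≤ len p
  long ε                a≢b = contradiction refl a≢b
  long ((_ , ≢ab) ◅ ε)  a≢b = contradiction (inj₁ (refl , refl)) ≢ab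
  long (_ ◅ _ ◅ _)      a≢b = s≤s (s≤s z≤n)

start∈ : {R : Rel (Fin n) 0ℓ} → ∀ {u v} (p : Star R u v) → u ∈ vertices p
start∈ ε       = here refl
start∈ (_ ◅ _) = here refl

end∈ : {R : Rel (Fin n) 0ℓ} → ∀ {u v} (p : Star R u v) → v ∈ vertices p
end∈ ε       = here refl
end∈ (_ ◅ p) = there (end∈ p)

-- Maximality of a spanning forest

addEdge : (F : Graph n) → ∀ x y → x ≢ y → Graph n
addEdge {n} F x y x≢y = record
  { adj = λ u v → adj F u v ∨ joins u v ∨ joins v u
  ; symm = λ u v → cong₂ _∨_ (symm F u v) (Bool.∨-comm (joins u v) (joins v u))
  ; irrefl = λ v → cong₂ _∨_ (irrefl F v) (cong₂ _∨_ (not-both v) (not-both v))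
  }
  where
  joins : Fin n → Fin n → Bool
  joins u v = (u == x) ∧ (v == y)
  not-both : ∀ v → joins v v ≡ false
  not-both v with v ≟ x | v ≟ y
  ... | yes p | yes q = contradiction (trans (sym p) q) x≢y
  ... | yes _ | no  _ = refl
  ... | no  _ | _     = refl

module _ (F : Graph n) {x y : Fin n} (x≢y : x ≢ y) (separated : ¬ Star (Adj F) y x) where

  private
    H : Graph n
    H = addEdge F x y x≢y

    Y : Side n
    Y = Reach.reached (reach (Adj? F) y)

    Yx : Y x ≡ false
    Yx = Bool.¬-not (separated ∘ Reach.sound (reach (Adj? F) y) x)

    Yy : Y y ≡ true
    Yy = Reach.base (reach (Adj? F) y)

    Y-step : ∀ {u v} → Adj F u v → Y u ≡ Y v
    Y-step {u} {v} uv = iff-≡ (Reach.closed (reach (Adj? F) y) uv) (Reach.closed (reach (Adj? F) y) (Adj-sym F uv))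

  addEdge-step : ∀ {u v} → Adj H u v → Adj F u v ⊎ (u ≡ x × v ≡ y) ⊎ (u ≡ y × v ≡ x)
  addEdge-step {u} {v} uv with true∨ {adj F u v} (T⇒≡ uv)
  ... | inj₁ p = inj₁ (≡⇒T p)
  ... | inj₂ p with true∨ {(u == x) ∧ (v == y)} p
  ...   | inj₁ q = let r , s = true∧ {u == x} q in inj₂ (inj₁ (==-sound r , ==-sound s))
  ...   | inj₂ q = let r , s = true∧ {v == x} q in inj₂ (inj₂ (==-sound s , ==-sound r))

  private
    Crossing : ∀ {u v} → Star (Adj H) u v → Set
    Crossing {u} {v} p = x ∈ vertices p × y ∈ vertices p × Y u ≢ Y v

    Old : ∀ {u v} → Star (Adj H) u v → Set
    Old {u} {v} p = Σ (Star (Adj F) u v) λ q → vertices q ≡ vertices p × len q ≡ len p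

    Old⇒Y : ∀ {u v} → Star (Adj F) u v → Y u ≡ Y v
    Old⇒Y ε       = refl
    Old⇒Y (s ◅ p) = trans (Y-step s) (Old⇒Y p)

    Yx≢Yy : Y x ≢ Y y
    Yx≢Yy eq = contradiction (trans (sym Yy) (trans (sym eq) Yx)) true≢false

    -- A simple path takes the new edge at most once, since taking it uses up both `x` and `y`; and
    -- the new edge is the only one that changes the side of `Y`.
    classify : ∀ {u v} (p : Star (Adj H) u v) → Unique (vertices p) → Old p ⊎ Crossing p
    classify ε uniq = inj₁ (ε , refl , refl)
    classify (s ◅ p) (u∉ ∷ uniq) with addEdge-step s | classify p uniq
    ... | inj₁ t | inj₁ (q , vs , l) = inj₁ (t ◅ q , cong (_ ∷_) vs , cong suc l)
    ... | inj₁ t | inj₂ (x∈ , y∈ , ≢) = inj₂ (there x∈ , there y∈ , ≢ ∘ trans (sym (Y-step t)))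
    ... | inj₂ (inj₁ (refl , refl)) | inj₁ (q , _) = inj₂ (here refl , there (start∈ p) , Yx≢Yy ∘ flip trans (sym (Old⇒Y q)))
    ... | inj₂ (inj₂ (refl , refl)) | inj₁ (q , _) = inj₂ (there (start∈ p) , here refl , Yx≢Yy ∘ sym ∘ flip trans (sym (Old⇒Y q)))
    ... | inj₂ (inj₁ (refl , refl)) | inj₂ (x∈ , _ , _) = contradiction x∈ (All¬⇒¬Any u∉)
    ... | inj₂ (inj₂ (refl , refl)) | inj₂ (_ , y∈ , _) = contradiction y∈ (All¬⇒¬Any u∉)

    -- A simple path between `x` and `y` that takes the new edge consists of that edge alone, so the
    -- new edge cannot both lie on a cycle's path and close it.
    not-closed : ∀ {u v} (p : Star (Adj H) u v) → Unique (vertices p) → 2 ≤ len p →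
                 (u ≡ x × v ≡ y) ⊎ (u ≡ y × v ≡ x) → ¬ Crossing p
    not-closed (s ◅ ε) uniq (s≤s ()) ends
    not-closed (s ◅ t ◅ p) (u∉ ∷ w∉ ∷ uniq) _ ends (x∈ , y∈ , ≢) with addEdge-step s
    ... | inj₁ old = [ (λ { (refl , refl) → All¬⇒¬Any u∉ (proj₁ tail) }) , (λ { (refl , refl) → All¬⇒¬Any u∉ (proj₂ tail) }) ]′ ends
      where
      tail : x ∈ vertices (t ◅ p) × y ∈ vertices (t ◅ p)
      tail with classify (t ◅ p) (w∉ ∷ uniq)
      ... | inj₁ (q , _) = contradiction (trans (Y-step old) (Old⇒Y q)) ≢
      ... | inj₂ (x∈ , y∈ , _) = x∈ , y∈
    not-closed (s ◅ t ◅ p) (u∉ ∷ w∉ ∷ uniq) _ (inj₁ (refl , refl)) _ | inj₂ (inj₁ (refl , refl)) = All¬⇒¬Any w∉ (end∈ p)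
    not-closed (s ◅ t ◅ p) (u∉ ∷ w∉ ∷ uniq) _ (inj₂ (refl , refl)) _ | inj₂ (inj₁ (eq , refl)) = x≢y (sym eq)
    not-closed (s ◅ t ◅ p) (u∉ ∷ w∉ ∷ uniq) _ (inj₁ (refl , refl)) _ | inj₂ (inj₂ (eq , refl)) = x≢y eq
    not-closed (s ◅ t ◅ p) (u∉ ∷ w∉ ∷ uniq) _ (inj₂ (refl , refl)) _ | inj₂ (inj₂ (refl , refl)) = All¬⇒¬Any w∉ (end∈ p)

  addEdge-acyclic : Acyclic F → Acyclic H
  addEdge-acyclic acyclic (u , v , p , uniq , 2≤len , vu) with addEdge-step vu | classify p uniq
  ... | inj₁ old | inj₁ (q , vs , l) = acyclic (u , v , q , subst Unique (sym vs) uniq , subst (2 ≤_) (sym l) 2≤len , old)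
  ... | inj₁ old | inj₂ (_ , _ , ≢) = ≢ (sym (Y-step old))
  ... | inj₂ (inj₁ (refl , refl)) | inj₁ (q , _) = Yx≢Yy (sym (Old⇒Y q))
  ... | inj₂ (inj₂ (refl , refl)) | inj₁ (q , _) = Yx≢Yy (Old⇒Y q)
  ... | inj₂ (inj₁ (refl , refl)) | inj₂ cr = not-closed p uniq 2≤len (inj₂ (refl , refl)) cr
  ... | inj₂ (inj₂ (refl , refl)) | inj₂ cr = not-closed p uniq 2≤len (inj₁ (refl , refl)) cr

-- If `x` and `y` lay in different components of `F`, adding the edge between them would create no
-- cycle, and maximality would put it into `F`.
spanning : {G F : Graph n} → SpanningForest G F → ∀ {x y} → Adj G x y → Star (Adj F) y x
spanning {G = G} {F} forest {x} {y} xy = decide (reached x) refl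
  where
  open SpanningForest forest
  open Reach (reach (Adj? F) y) using (reached; sound; base)
  x≢y : x ≢ y
  x≢y = Adj⇒≢ G xy
  decide : ∀ b → reached x ≡ b → Star (Adj F) y x
  decide true  eq = sound x eq
  decide false eq = (Adj-sym F new-edge) ◅ ε
    where
    open Reach (reach (Adj? F) y) using (closed*)
    separated : ¬ Star (Adj F) y x
    separated p = contradiction (trans (sym (closed* p base)) eq) true≢false
    old : F ⊑ addEdge F x y x≢y
    old u v uv = ≡⇒T (∨-trueˡ _ (T⇒≡ uv))
    within-G : addEdge F x y x≢y ⊑ G
    within-G u v uv with addEdge-step F x≢y separated uv
    ... | inj₁ p = subgraph u v p
    ... | inj₂ (inj₁ (refl , refl)) = xy
    ... | inj₂ (inj₂ (refl , refl)) = Adj-sym G xy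
    new-edge : Adj F x y
    new-edge = maximal (addEdge F x y x≢y) old within-G (addEdge-acyclic F x≢y separated acyclic) x y
      (≡⇒T (∨-trueʳ (adj F x y) (∨-trueˡ _ (∧-true (==-refl x) (==-refl y)))))

-- Parity

odd⇒¬2∣ : ∀ {l} → odd l ≡ true → ¬ (2 ∣ l)
odd⇒¬2∣ odd-l (divides q refl) = contradiction (trans (sym odd-l) (even q)) true≢false
  where
  even : ∀ q → odd (q * 2) ≡ false
  even zero    = refl
  even (suc q) = trans (Bool.not-involutive _) (even q)

parity : ∀ {m} → (Fin m → Bool) → List (Fin m) → Bool
parity q []       = false
parity q (i ∷ is) = q i xor parity q is

parity-tabulate : ∀ {m k} (q : Fin m → Bool) (f : Fin k → Fin m) → parity q (tabulateᴸ f) ≡ ⨁ (q ∘ f)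
parity-tabulate {k = zero}  q f = refl
parity-tabulate {k = suc k} q f = cong (q (f zero) xor_) (parity-tabulate q (f ∘ suc))

-- The list is filtered from the list of all indices, so the parity of its length is the sum of `q`;
-- injectivity of `index` ensures that the one element chosen per index is the only one.
oddlyMany : ∀ {A : Set} {P : Pred A 0ℓ} {m} (index : A → Fin m) (q : Fin m → Bool) →
            (∀ {x y} → index x ≡ index y → x ≡ y) → (∀ x → P x → q (index x) ≡ true) →
            (∀ i → q i ≡ true → ∃ λ x → index x ≡ i × P x) → ⨁ q ≡ true → OddlyMany P
oddlyMany {A} {P} {m} index q injective to from ⨁q with collect (allFin m) (allFin⁺ m)
  where
  collect : ∀ is → Unique is → Σ (List A) λ xs → Unique xs × (∀ x → x ∈ xs ⇔ (index x ∈ is × P x)) × odd (length xs) ≡ parity q is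
  collect [] uniq = [] , [] , (λ x → mk⇔ (λ ()) λ ()) , refl
  collect (i ∷ is) (i∉ ∷ uniq) with collect is uniq | q i in qi
  ... | xs , uniq-xs , members , odd-xs | false = xs , uniq-xs , (λ x → mk⇔ (there′ x) (back x)) , odd-xs
    where
    there′ : ∀ x → x ∈ xs → index x ∈ (i ∷ is) × P x
    there′ x x∈ = let j , Px = Equivalence.to (members x) x∈ in there j , Px
    back : ∀ x → index x ∈ (i ∷ is) × P x → x ∈ xs
    back x (here refl , Px) = contradiction (trans (sym (to x Px)) qi) true≢false
    back x (there j , Px)   = Equivalence.from (members x) (j , Px)
  ... | xs , uniq-xs , members , odd-xs | true with from i qi
  ...   | y , refl , Py = y ∷ xs , ¬Any⇒All¬ xs (λ y∈ → All¬⇒¬Any i∉ (proj₁ (Equivalence.to (members y) y∈))) ∷ uniq-xs ,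
          (λ x → mk⇔ (there′ x) (back x)) , cong not odd-xs
    where
    there′ : ∀ x → x ∈ (y ∷ xs) → index x ∈ (index y ∷ is) × P x
    there′ x (here refl) = here refl , Py
    there′ x (there x∈)  = let j , Px = Equivalence.to (members x) x∈ in there j , Px
    back : ∀ x → index x ∈ (index y ∷ is) × P x → x ∈ (y ∷ xs)
    back x (here eq , Px) = here (injective eq)
    back x (there j , Px) = there (Equivalence.from (members x) (j , Px))
... | xs , uniq , members , odd-xs =
  xs , uniq , (λ x → mk⇔ (proj₂ ∘ Equivalence.to (members x)) λ Px → Equivalence.from (members x) (∈-allFin _ , Px)) ,
  odd⇒¬2∣ (trans odd-xs (trans (parity-tabulate q id) ⨁q))

-- If every colour class of z were even, any sum of a function of the colour over z would vanish.
odd-colour : ∀ {m k} (colour : Fin m → Fin k) (g : Fin k → Bool) (z : Fin m → Bool) →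
             ⨁ (λ i → g (colour i) ∧ z i) ≡ true → ∃ λ κ → ⨁ (λ i → (colour i == κ) ∧ z i) ≡ true
odd-colour {m} {k} colour g z total with any? (λ κ → ⨁ (λ i → (colour i == κ) ∧ z i) Bool.≟ true)
... | yes κ   = κ
... | no none = contradiction (trans (sym total) (begin
  ⨁ (λ i → g (colour i) ∧ z i)                             ≡⟨ ⊕.sum-cong-≗ spread ⟩
  ⨁ (λ i → ⨁ λ κ → g κ ∧ ((colour i == κ) ∧ z i))          ≡⟨ ⊕.∑-comm (λ i κ → g κ ∧ ((colour i == κ) ∧ z i)) ⟩
  ⨁ (λ κ → ⨁ λ i → g κ ∧ ((colour i == κ) ∧ z i))          ≡⟨ sum-zero xor-commutativeMonoid _ class ⟩
  false                                                    ∎)) true≢false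
  where
  open ≡-Reasoning
  spread : ∀ i → g (colour i) ∧ z i ≡ ⨁ λ κ → g κ ∧ ((colour i == κ) ∧ z i)
  spread i = sym (trans
    (sum-point xor-commutativeMonoid _ (colour i) λ κ κ≢ →
      trans (cong (λ b → g κ ∧ (b ∧ z i)) (==-≢ (κ≢ ∘ sym))) (Bool.∧-zeroʳ (g κ)))
    (cong (λ b → g (colour i) ∧ (b ∧ z i)) (==-refl (colour i))))
  class : ∀ κ → ⨁ (λ i → g κ ∧ ((colour i == κ) ∧ z i)) ≡ false
  class κ with g κ
  ... | false = sum-zero xor-commutativeMonoid {m} (λ _ → false) λ _ → refl
  ... | true  = Bool.¬-not (none ∘ (κ ,_))

encode : Bool → Bool → Bool → Fin 8
encode false false false = 0F
encode false false true  = 1F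
encode false true  false = 2F
encode false true  true  = 3F
encode true  false false = 4F
encode true  false true  = 5F
encode true  true  false = 6F
encode true  true  true  = 7F

decode : Fin 8 → Bool × Bool × Bool
decode 0F = false , false , false
decode 1F = false , false , true
decode 2F = false , true  , false
decode 3F = false , true  , true
decode 4F = true  , false , false
decode 5F = true  , false , true
decode 6F = true  , true  , false
decode 7F = true  , true  , true

decode-encode : ∀ a b c → decode (encode a b c) ≡ (a , b , c)
decode-encode false false false = refl
decode-encode false false true  = refl
decode-encode false true  false = refl
decode-encode false true  true  = refl
decode-encode true  false false = refl
decode-encode true  false true  = refl
decode-encode true  true  false = refl
decode-encode true  true  true  = refl

-- Simple graphs as multigraphs

fst snd : ∀ {n} → Fin (n * n) → Fin n
fst {n} i = proj₁ (remQuot {n} n i)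
snd {n} i = proj₂ (remQuot {n} n i)

module _ {n} (G : Graph n) where

  isEdge : Fin n → Fin n → Bool
  isEdge u v = does (u Fin.<? v) ∧ adj G u v

  -- Pairs that are not edges become loops.
  multigraph : Multigraph n (n * n)
  multigraph = record { src = fst ; tgt = λ i → if isEdge (fst i) (snd i) then snd i else fst i }

  isEdge-intro : ∀ {u v} → u Fin.< v → Adj G u v → isEdge u v ≡ true
  isEdge-intro {u} {v} u<v uv = ∧-true (dec-true (u Fin.<? v) u<v) (T⇒≡ uv)

  isEdge-elim : ∀ {u v} → isEdge u v ≡ true → u Fin.< v × Adj G u v
  isEdge-elim {u} {v} eq = let lt , uv = true∧ eq in does-sound (u Fin.<? v) lt , ≡⇒T uv

  cross-edge : ∀ S {u v} → isEdge u v ≡ true → cross multigraph S (combine u v) ≡ S u xor S v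
  cross-edge S {u} {v} eq = at (remQuot {n} n (combine u v)) (remQuot-combine {n} {n} u v)
    where
    at : ∀ p → p ≡ (u , v) → S (proj₁ p) xor S (if isEdge (proj₁ p) (proj₂ p) then proj₂ p else proj₁ p) ≡ S u xor S v
    at _ refl = cong (λ b → S u xor S (if b then v else u)) eq

  cross-true : ∀ S i → cross multigraph S i ≡ true → isEdge (fst i) (snd i) ≡ true × S (fst i) xor S (snd i) ≡ true
  cross-true S i eq with isEdge (fst i) (snd i)
  ... | true  = refl , eq
  ... | false = contradiction (trans (sym eq) (Bool.xor-same (S (fst i)))) λ ()

  -- All other edges have both ends on one side of `S`, so a walk without the edge from `a` to `b`
  -- never changes sides.
  cutEdge⇒bridge : ∀ {a b} → a Fin.< b → Adj G a b → CutEdge multigraph (combine a b) → Bridge G a b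
  cutEdge⇒bridge {a} {b} a<b ab (S , Sab , others) = ab , λ walk →
    contradiction (trans (sym (trans (sym (cross-edge S (isEdge-intro a<b ab))) Sab)) (xor-≡ (constant walk))) true≢false
    where
    ordered-step : ∀ {u v} → u Fin.< v → Adj G u v → ¬ (u ≡ a × v ≡ b) → S u ≡ S v
    ordered-step {u} {v} u<v uv ≢ab = xor-false (trans (sym (cross-edge S (isEdge-intro u<v uv)))
      (others (combine u v) (≢ab ∘ combine-injective u v a b)))
    step : ∀ {u v} → deleteEdge G a b u v → S u ≡ S v
    step {u} {v} (uv , ≢ab) with Fin.<-cmp u v
    ... | tri< u<v _ _ = ordered-step u<v uv (≢ab ∘ inj₁)
    ... | tri≈ _ u≡v _ = contradiction u≡v (Adj⇒≢ G uv)
    ... | tri> _ _ v<u = sym (ordered-step v<u (Adj-sym G uv) λ (v≡a , u≡b) → ≢ab (inj₂ (u≡b , v≡a)))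
    constant : ∀ {u v} → Star (deleteEdge G a b) u v → S u ≡ S v
    constant ε       = refl
    constant (s ◅ p) = trans (step s) (constant p)

edge-≡ : ∀ {n} {H : Graph n} {e e′ : Edge H} → end₁ e ≡ end₁ e′ → end₂ e ≡ end₂ e′ → e ≡ e′
edge-≡ {e = edge u<v uv} {edge u<v′ uv′} refl refl = cong₂ edge (ℕ.<-irrelevant u<v u<v′) (Bool.T-irrelevant uv uv′)

index : ∀ {n} {H : Graph n} → Edge H → Fin (n * n)
index e = combine (end₁ e) (end₂ e)

index-injective : ∀ {n} {H : Graph n} {e e′ : Edge H} → index e ≡ index e′ → e ≡ e′
index-injective {e = e} {e′} eq = let p , q = combine-injective (end₁ e) (end₂ e) (end₁ e′) (end₂ e′) eq in edge-≡ p q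

-- Fundamental cuts and the colouring

module _ {n} {G F : Graph n} (forest : SpanningForest G F) where
  open SpanningForest forest

  module _ (f : Edge F) where
    private
      a b : Fin n
      a = end₁ f
      b = end₂ f

      R : Reach (deleteEdge F a b) a
      R = reach (deleteEdge? F a b) a

    open Reach R renaming (reached to S)

    private
      Sb : S b ≡ false
      Sb = Bool.¬-not (acyclic⇒separates F acyclic (adjacent f) ∘ sound b)

      same-side : ∀ {u v} → deleteEdge F a b u v → S u ≡ S v
      same-side {u} {v} uv = iff-≡ (closed uv) (closed (deleteEdge-sym F a b uv))

      same-side* : ∀ {u v} → Star (deleteEdge F a b) u v → S u ≡ S v
      same-side* ε       = refl
      same-side* (s ◅ p) = trans (same-side s) (same-side* p)

      -- Whenever the walk passes `f`, the path is restarted at the end of `f` just reached.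
      sides : ∀ {u v} → Star (Adj F) u v →
              Star (deleteEdge F a b) a u ⊎ Star (deleteEdge F a b) b u →
              Star (deleteEdge F a b) a v ⊎ Star (deleteEdge F a b) b v
      sides ε side = side
      sides {u} (_◅_ {j = w} uw p) side with (u ≟ a ×-dec w ≟ b) ⊎-dec (u ≟ b ×-dec w ≟ a)
      ... | yes (inj₁ (_ , refl)) = sides p (inj₂ ε)
      ... | yes (inj₂ (_ , refl)) = sides p (inj₁ ε)
      ... | no ≢ab = sides p ([ inj₁ ∘ (_◅◅ ((uw , ≢ab) ◅ ε)) , inj₂ ∘ (_◅◅ ((uw , ≢ab) ◅ ε)) ]′ side)

      -- A fundamental cut asks for `v` to be reachable from `b`, not just unreachable from `a`. As
      -- `F` spans, `v` lies in the component of `f`, which has only these two sides.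
      other-side : ∀ {u v} → Adj G u v → S u ≡ true → S v ≡ false → Star (deleteEdge F a b) b v
      other-side {u} {v} uv Su Sv with sides (spanning forest (Adj-sym G uv)) (inj₁ (sound u Su))
      ... | inj₁ av = contradiction (trans (sym (trans (sym (same-side* av)) base)) Sv) true≢false
      ... | inj₂ bv = bv

    M : Multigraph n (n * n)
    M = multigraph G

    inCut : Fin (n * n) → Bool
    inCut i = isEdge (G ∖ F) (fst i) (snd i) ∧ cross M S i

    ∖-isEdge : ∀ {u v} → isEdge (G ∖ F) u v ≡ true → isEdge G u v ≡ true × adj F u v ≡ false
    ∖-isEdge {u} {v} eq =
      let u<v , uv = isEdge-elim (G ∖ F) eq
          Guv , ¬Fuv = true∧ {adj G u v} (T⇒≡ uv)
      in isEdge-intro G u<v (≡⇒T Guv) , not-true ¬Fuv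

    inCut⇒ : ∀ i → inCut i ≡ true → ∃ λ (e : Edge (G ∖ F)) → index e ≡ i × FundamentalCut G F f (∖-edge G F e)
    inCut⇒ i eq with edge-i , cross-i ← true∧ {isEdge (G ∖ F) (fst i) (snd i)} eq
                with u<v , uv ← isEdge-elim (G ∖ F) edge-i = edge u<v uv , combine-remQuot {n} n i , cut
      where
      Guv : Adj G (fst i) (snd i)
      Guv = ≡⇒T (proj₁ (true∧ {adj G (fst i) (snd i)} (T⇒≡ uv)))
      cut : FundamentalCut G F f (∖-edge G F (edge u<v uv))
      cut with xor-true (proj₂ (cross-true G S i cross-i))
      ... | inj₁ (Su , Sv) = inj₁ (sound _ Su , other-side Guv Su Sv)
      ... | inj₂ (Su , Sv) = inj₂ (sound _ Sv , other-side (Adj-sym G Guv) Sv Su)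

    inCut⇐ : ∀ e → FundamentalCut G F f (∖-edge G F e) → inCut (index e) ≡ true
    inCut⇐ e@(edge {u} {v} u<v uv) cut = ∧-true edge-e (trans (cross-edge G S (proj₁ (∖-isEdge (isEdge-intro (G ∖ F) u<v uv)))) (crossing cut))
      where
      edge-e : isEdge (G ∖ F) (fst (combine u v)) (snd (combine u v)) ≡ true
      edge-e = trans (cong (λ (x , y) → isEdge (G ∖ F) x y) (remQuot-combine {n} {n} u v)) (isEdge-intro (G ∖ F) u<v uv)
      crossing : FundamentalCut G F f (∖-edge G F e) → S u xor S v ≡ true
      crossing (inj₁ (au , bv)) = cong₂ _xor_ (trans (sym (same-side* au)) base) (trans (sym (same-side* bv)) Sb)
      crossing (inj₂ (av , bu)) = cong₂ _xor_ (trans (sym (same-side* bu)) Sb) (trans (sym (same-side* av)) base)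

    f-edge : isEdge G a b ≡ true
    f-edge = isEdge-intro G (ordered f) (subgraph a b (adjacent f))

    f-cross : cross M S (index f) ≡ true
    f-cross = trans (cross-edge G S f-edge) (cong₂ _xor_ base Sb)

    f∉cut : inCut (index f) ≡ false
    f∉cut = cong (_∧ cross M S (index f)) (trans (cong (λ (x , y) → isEdge (G ∖ F) x y) (remQuot-combine {n} {n} a b))
      (Bool.¬-not λ eq → contradiction (trans (sym (T⇒≡ (adjacent f))) (proj₂ (∖-isEdge {a} {b} eq))) true≢false))

    -- The only edge of the cut in F is f itself.
    cut-edges : ∀ i → i ≢ index f → cross M S i ≡ inCut i
    cut-edges i i≢f = decide (cross M S i) refl (isEdge (G ∖ F) (fst i) (snd i)) refl
      where
      u v : Fin n
      u = fst i
      v = snd i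
      decide : ∀ c → cross M S i ≡ c → ∀ d → isEdge (G ∖ F) u v ≡ d → cross M S i ≡ inCut i
      decide _     _  true  eq = sym (cong (_∧ cross M S i) eq)
      decide false ci false eq = trans ci (sym (cong (_∧ cross M S i) eq))
      decide true  ci false eq with Guv , Suv ← cross-true G S i ci =
        contradiction (trans (sym Suv) (xor-≡ (same-side (Fuv , not-f)))) true≢false
        where
        u<v : u Fin.< v
        u<v = proj₁ (isEdge-elim G Guv)
        Fuv : Adj F u v
        Fuv = Dec.decidable-stable (Adj? F u v) λ ¬Fuv → contradiction
          (trans (sym (isEdge-intro (G ∖ F) u<v (≡⇒T (∧-true (T⇒≡ (proj₂ (isEdge-elim G Guv))) (cong not (Bool.¬-not (¬Fuv ∘ ≡⇒T))))))) eq) true≢false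
        not-f : ¬ ((u ≡ a × v ≡ b) ⊎ (u ≡ b × v ≡ a))
        not-f (inj₁ (u≡a , v≡b)) = i≢f (trans (sym (combine-remQuot {n} n i)) (cong₂ combine u≡a v≡b))
        not-f (inj₂ (u≡b , v≡a)) = ℕ.<-asym (ordered f) (subst₂ Fin._<_ u≡b v≡a u<v)

    cut-sum : ∀ φ → _⟂_ M φ S → ⨁ (λ i → φ i ∧ inCut i) ≡ φ (index f)
    cut-sum φ φ⟂ = sym (xor-false (begin
      φ (index f) xor ⨁ (λ i → φ i ∧ inCut i)                               ≡⟨ cong (_xor ⨁ (λ i → φ i ∧ inCut i)) point ⟨
      ⨁ (λ i → (i == index f) ∧ φ i) xor ⨁ (λ i → φ i ∧ inCut i)            ≡⟨ ⊕.∑-distrib-+ (λ i → (i == index f) ∧ φ i) (λ i → φ i ∧ inCut i) ⟨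
      ⨁ (λ i → ((i == index f) ∧ φ i) xor (φ i ∧ inCut i))                  ≡⟨ ⊕.sum-cong-≗ split ⟨
      pair M φ S                                                            ≡⟨ φ⟂ ⟩
      false                                                                 ∎))
      where
      open ≡-Reasoning
      point : ⨁ (λ i → (i == index f) ∧ φ i) ≡ φ (index f)
      point = trans (sum-point xor-commutativeMonoid (λ i → (i == index f) ∧ φ i) (index f) λ i i≢f →
        cong (_∧ φ i) (==-≢ i≢f)) (cong (_∧ φ (index f)) (==-refl (index f)))
      split : ∀ i → φ i ∧ cross M S i ≡ ((i == index f) ∧ φ i) xor (φ i ∧ inCut i)
      split i = [ (λ { refl → at-f }) , elsewhere ]′ (Dec.toSum (i ≟ index f))
        where
        at-f : φ (index f) ∧ cross M S (index f) ≡ ((index f == index f) ∧ φ (index f)) xor (φ (index f) ∧ inCut (index f))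
        at-f = begin
          φ (index f) ∧ cross M S (index f)     ≡⟨ cong (φ (index f) ∧_) f-cross ⟩
          φ (index f) ∧ true                    ≡⟨ Bool.∧-identityʳ _ ⟩
          φ (index f)                           ≡⟨ Bool.xor-identityʳ _ ⟨
          φ (index f) xor false                 ≡⟨ cong₂ _xor_ (cong (_∧ φ (index f)) (==-refl (index f))) (trans (cong (φ (index f) ∧_) f∉cut) (Bool.∧-zeroʳ _)) ⟨
          ((index f == index f) ∧ φ (index f)) xor (φ (index f) ∧ inCut (index f)) ∎
        elsewhere : i ≢ index f → φ i ∧ cross M S i ≡ ((i == index f) ∧ φ i) xor (φ i ∧ inCut i)
        elsewhere i≢f = trans (cong (φ i ∧_) (cut-edges i i≢f)) (cong (λ b → (b ∧ φ i) xor (φ i ∧ inCut i)) (sym (==-≢ i≢f)))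

  open EightFlow (eightFlow (multigraph G))

  colour : Fin (n * n) → Fin 8
  colour i = encode (f₁ i) (f₂ i) (f₃ i)

  occursOddly : ∀ f → ¬ Bridge G (end₁ f) (end₂ f) → ∃ λ κ → OccursOddly G F (colour ∘ index) f κ
  occursOddly f no-bridge = [ some-flow , (λ cut → contradiction (cutEdge⇒bridge G (ordered f) (subgraph _ _ (adjacent f)) cut) no-bridge) ]′ (nonzero (index f))
    where
    open Reach (reach (deleteEdge? F (end₁ f) (end₂ f)) (end₁ f)) using () renaming (reached to S)

    finish : (∃ λ κ → ⨁ (λ i → (colour i == κ) ∧ inCut f i) ≡ true) → ∃ λ κ → OccursOddly G F (colour ∘ index) f κ
    finish (κ , total) = κ , oddlyMany index (λ i → (colour i == κ) ∧ inCut f i) index-injective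
      (λ e (cut , eq) → ∧-true (trans (cong (_== κ) eq) (==-refl κ)) (inCut⇐ f e cut))
      (λ i eq → let ci , zi = true∧ {colour i == κ} eq ; e , e≡i , cut = inCut⇒ f i zi in
                e , e≡i , cut , trans (cong colour e≡i) (==-sound ci))
      total

    -- A coordinate `φ` of the flow that is nonzero on `f` sums to 1 over the cut. It is a function
    -- `g` of the colour, so some colour class of the cut is odd.
    with-flow : ∀ φ (g : Fin 8 → Bool) → (∀ i → g (colour i) ≡ φ i) → _⟂_ (multigraph G) φ S → φ (index f) ≡ true →
                ∃ λ κ → OccursOddly G F (colour ∘ index) f κ
    with-flow φ g g≡φ φ⟂ φf = finish (odd-colour colour g (inCut f)
      (trans (⊕.sum-cong-≗ λ i → cong (_∧ inCut f i) (g≡φ i)) (trans (cut-sum f φ φ⟂) φf)))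

    decode-colour : ∀ i → decode (colour i) ≡ (f₁ i , f₂ i , f₃ i)
    decode-colour i = decode-encode (f₁ i) (f₂ i) (f₃ i)

    some-flow : f₁ (index f) ∨ f₂ (index f) ∨ f₃ (index f) ≡ true → ∃ λ κ → OccursOddly G F (colour ∘ index) f κ
    some-flow nz = [ with-flow f₁ (proj₁ ∘ decode) (cong proj₁ ∘ decode-colour) (even₁ S) ,
                   [ with-flow f₂ (proj₁ ∘ proj₂ ∘ decode) (cong (proj₁ ∘ proj₂) ∘ decode-colour) (even₂ S) ,
                     with-flow f₃ (proj₂ ∘ proj₂ ∘ decode) (cong (proj₂ ∘ proj₂) ∘ decode-colour) (even₃ S) ]′ ∘ true∨ {f₂ (index f)} ]′
                   (true∨ {f₁ (index f)} nz)

-- Small clique minors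

∈-tabulate⁺ : ∀ {n} (S : Side n) {v} → S v ≡ true → v ∈ₛ tabulate S
∈-tabulate⁺ S {v} Sv = lookup⇒[]= v (tabulate S) (trans (lookup∘tabulate S v) Sv)

∈-tabulate⁻ : ∀ {n} (S : Side n) {v} → v ∈ₛ tabulate S → S v ≡ true
∈-tabulate⁻ S {v} v∈ = trans (sym (lookup∘tabulate S v)) ([]=⇒lookup v∈)

K-≢ : ∀ {t} {i j : Fin t} → Adj (K t) i j → i ≢ j
K-≢ {t} = Adj⇒≢ (K t)

K-adj : ∀ {t} {i j : Fin t} → i ≢ j → Adj (K t) i j
K-adj i≢j = ≡⇒T (cong not (==-≢ i≢j))

K-minor-≤ : ∀ {n s t} {G : Graph n} → s ≤ t → K t IsMinorOf G → K s IsMinorOf G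
K-minor-≤ s≤t minor = record
  { branch    = λ i → branch (Fin.inject≤ i s≤t)
  ; nonempty  = λ i → nonempty (Fin.inject≤ i s≤t)
  ; disjoint  = λ i j i≢j → disjoint _ _ (i≢j ∘ inject≤-injective s≤t s≤t i j)
  ; connected = λ i → connected (Fin.inject≤ i s≤t)
  ; joined    = λ i j ij → joined _ _ (K-adj (K-≢ ij ∘ inject≤-injective s≤t s≤t i j))
  }
  where open _IsMinorOf_ minor

module _ {n} (G : Graph n) {a b : Fin n} (ab : Adj G a b) where

  Avoiding : Rel (Fin n) _
  Avoiding u v = Adj G u v × u ≢ a × v ≢ a

  -- Keeps the part of the walk after its last visit to `a`; `x` is the vertex that follows this
  -- visit.
  lastExit : ∀ {w} → Star (deleteEdge G a b) w b →
             (Star Avoiding w b × w ≢ a) ⊎ (∃ λ x → deleteEdge G a b a x × x ≢ a × Star Avoiding x b)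
  lastExit ε = inj₁ (ε , Adj⇒≢ G ab ∘ sym)
  lastExit {w} (s ◅ p) with lastExit p
  ... | inj₂ exit = inj₂ exit
  ... | inj₁ (q , w′≢a) with w ≟ a
  ...   | yes refl = inj₂ (_ , s , w′≢a , q)
  ...   | no  w≢a  = inj₁ ((proj₁ s , w≢a , w′≢a) ◅ q , w≢a)

  module _ {x : Fin n} (ax : Adj G a x) (x≢a : x ≢ a) (x≢b : x ≢ b) (walk : Star Avoiding x b) where

    Inner : Rel (Fin n) _
    Inner u v = Adj G u v × v ≢ a × v ≢ b

    inner : Reach Inner x
    inner = reach (λ u v → Adj? G u v ×-dec ¬? (v ≟ a) ×-dec ¬? (v ≟ b)) x

    open Reach inner renaming (reached to B)

    B-avoids : ∀ v → B v ≡ true → v ≢ a × v ≢ b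
    B-avoids v Bv = ends (sound v Bv) (x≢a , x≢b)
      where
      ends : ∀ {u v} → Star Inner u v → u ≢ a × u ≢ b → v ≢ a × v ≢ b
      ends ε       ok = ok
      ends (s ◅ p) ok = ends p (proj₂ s)

    -- The walk avoids `a`, so it stays in `B` up to its first step to `b`.
    entrance : ∀ {w} → B w ≡ true → w ≢ b → Star Avoiding w b → ∃ λ y → B y ≡ true × Adj G y b
    entrance Bw w≢b ε = contradiction refl w≢b
    entrance {w} Bw w≢b (_◅_ {j = w′} (ww′ , w≢a , w′≢a) p) with w′ ≟ b
    ... | yes refl = w , Bw , ww′
    ... | no w′≢b  = entrance (closed (ww′ , w′≢a , w′≢b) Bw) w′≢b p

    -- The branch sets of the triangle: `B` is the component of `x` after deleting `a` and `b`,
    -- joined to `a` by the last exit and to `b` by the entrance.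
    side : Fin 3 → Side n
    side 0F = ⁅ a ⁆
    side 1F = ⁅ b ⁆
    side 2F = B

    side-disjoint : ∀ i j → i ≢ j → ∀ v → side i v ≡ true → side j v ≢ true
    side-disjoint 0F 0F i≢j v p q = contradiction refl i≢j
    side-disjoint 1F 1F i≢j v p q = contradiction refl i≢j
    side-disjoint 2F 2F i≢j v p q = contradiction refl i≢j
    side-disjoint 0F 1F i≢j v p q = Adj⇒≢ G ab (trans (sym (==-sound {i = v} p)) (==-sound q))
    side-disjoint 1F 0F i≢j v p q = Adj⇒≢ G ab (trans (sym (==-sound {i = v} q)) (==-sound p))
    side-disjoint 0F 2F i≢j v p q = proj₁ (B-avoids v q) (==-sound p)
    side-disjoint 2F 0F i≢j v p q = proj₁ (B-avoids v p) (==-sound q)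
    side-disjoint 1F 2F i≢j v p q = proj₂ (B-avoids v q) (==-sound p)
    side-disjoint 2F 1F i≢j v p q = proj₂ (B-avoids v p) (==-sound q)

    side-connected : ∀ i u v → side i u ≡ true → side i v ≡ true → Star (induced G (tabulate (side i))) u v
    side-connected 0F u v p q = subst (Star _ u) (trans (==-sound {i = u} p) (sym (==-sound {i = v} q))) ε
    side-connected 1F u v p q = subst (Star _ u) (trans (==-sound {i = u} p) (sym (==-sound {i = v} q))) ε
    side-connected 2F u v p q = Star.reverse reversed (from-x u p) ◅◅ from-x v q
      where
      from-x : ∀ v → B v ≡ true → Star (induced G (tabulate B)) x v
      from-x v Bv = Star.map (λ (Bs , Bt , st , _) → ∈-tabulate⁺ B Bs , ∈-tabulate⁺ B Bt , st) (path v Bv)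
      reversed : ∀ {s t} → induced G (tabulate B) s t → induced G (tabulate B) t s
      reversed (Bs , Bt , st) = Bt , Bs , Adj-sym G st

    side-joined : ∀ i j → i ≢ j → ∃₂ λ u v → side i u ≡ true × side j v ≡ true × Adj G u v
    side-joined 0F 0F i≢j = contradiction refl i≢j
    side-joined 1F 1F i≢j = contradiction refl i≢j
    side-joined 2F 2F i≢j = contradiction refl i≢j
    side-joined 0F 1F i≢j = a , b , ==-refl a , ==-refl b , ab
    side-joined 1F 0F i≢j = b , a , ==-refl b , ==-refl a , Adj-sym G ab
    side-joined 0F 2F i≢j = a , x , ==-refl a , base , ax
    side-joined 2F 0F i≢j = x , a , base , ==-refl a , Adj-sym G ax
    side-joined 1F 2F i≢j = let y , By , yb = entrance base x≢b walk in b , y , ==-refl b , By , Adj-sym G yb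
    side-joined 2F 1F i≢j = let y , By , yb = entrance base x≢b walk in y , b , By , ==-refl b , yb

    side-nonempty : ∀ i → ∃ λ v → side i v ≡ true
    side-nonempty 0F = a , ==-refl a
    side-nonempty 1F = b , ==-refl b
    side-nonempty 2F = x , base

    triangle-minor : K 3 IsMinorOf G
    triangle-minor = record
      { branch    = tabulate ∘ side
      ; nonempty  = λ i → let v , p = side-nonempty i in v , ∈-tabulate⁺ (side i) p
      ; disjoint  = λ i j i≢j (v , v∈) → let v∈i , v∈j = x∈p∩q⁻ _ _ v∈ in
                    side-disjoint i j i≢j v (∈-tabulate⁻ (side i) v∈i) (∈-tabulate⁻ (side j) v∈j)
      ; connected = λ i u v u∈ v∈ → side-connected i u v (∈-tabulate⁻ (side i) u∈) (∈-tabulate⁻ (side i) v∈)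
      ; joined    = λ i j ij → let u , v , p , q , uv = side-joined i j (K-≢ ij) in
                    u , v , ∈-tabulate⁺ (side i) p , ∈-tabulate⁺ (side j) q , uv
      }

  cycle⇒triangle-minor : Star (deleteEdge G a b) a b → K 3 IsMinorOf G
  cycle⇒triangle-minor walk with lastExit walk
  ... | inj₁ (_ , a≢a) = contradiction refl a≢a
  ... | inj₂ (x , (ax , ≢ab) , x≢a , q) = triangle-minor ax x≢a (λ { refl → ≢ab (inj₁ (refl , refl)) }) q

  nonbridge⇒triangle-minor : ¬ Bridge G a b → K 3 IsMinorOf G
  nonbridge⇒triangle-minor nonbridge = cycle⇒triangle-minor (Dec.decidable-stable
    (map′ (sound b) (λ p → closed* p base) (reached b Bool.≟ true)) λ none → nonbridge (ab , none))
    where open Reach (reach (deleteEdge? G a b) a)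

-- Star-arboricity of an edge

K₂-starForest : StarForest (K 2)
K₂-starForest = acyclic , diameter
  where
  no-three : (i j l : Fin 2) → i ≢ j → i ≢ l → j ≢ l → ⊥
  no-three 0F 0F _  p q r = p refl
  no-three 0F 1F 0F p q r = q refl
  no-three 0F 1F 1F p q r = r refl
  no-three 1F 1F _  p q r = p refl
  no-three 1F 0F 1F p q r = q refl
  no-three 1F 0F 0F p q r = r refl

  acyclic : Acyclic (K 2)
  acyclic (_ , _ , _ ◅ ε , _ , s≤s () , _)
  acyclic (_ , _ , _ ◅ _ ◅ ε , ((p ∷ q ∷ []) ∷ (r ∷ []) ∷ _) , _) = no-three _ _ _ p q r
  acyclic (_ , _ , _ ◅ _ ◅ _ ◅ _ , ((p ∷ q ∷ _) ∷ (r ∷ _) ∷ _) , _) = no-three _ _ _ p q r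

  diameter : ComponentDiameters≤ 2 (K 2)
  diameter u v _ with u ≟ v
  ... | yes refl = ε , z≤n
  ... | no  u≢v  = (K-adj u≢v ◅ ε) , s≤s z≤n

K₂-starArboricity : IsStarArboricity (K 2) 1
K₂-starArboricity = decomposition , at-least-one
  where
  decomposition : StarDecomposition (K 2) 1
  decomposition = record
    { part        = λ _ → K 2
    ; part⊑       = λ _ _ _ uv → uv
    ; starForest  = λ _ → K₂-starForest
    ; partitioned = λ u v uv → 0F , uv , λ { {0F} _ → refl }
    }
  at-least-one : ∀ m → StarDecomposition (K 2) m → 1 ≤ m
  at-least-one zero    D with () ← proj₁ (StarDecomposition.partitioned D 0F 1F tt)
  at-least-one (suc m) D = s≤s z≤n

K₂-no-minor : ∀ {s} → 3 ≤ s → ¬ (K s IsMinorOf K 2)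
K₂-no-minor 3≤s minor with i , j , i<j , eq ← pigeonhole 3≤s (proj₁ ∘ _IsMinorOf_.nonempty minor) =
  disjoint i j (Fin.<⇒≢ i<j) (_ , x∈p∩q⁺ (proj₂ (nonempty i) , subst (_∈ₛ branch j) (sym eq) (proj₂ (nonempty j))))
  where open _IsMinorOf_ minor

theorem1p5 : ∀ (t L : ℕ) → Isℓ (t ∸ 1) L →
    ∃ λ k → k ≤ 16 * L + 1 ×
    (∀ n (G T : Graph n) → ¬ (K t IsMinorOf G) → SpanningForest G T →
    Σ (Edge (G ∖ T) → Fin k) λ φ →
    ∀ (f : Edge T) → ¬ Bridge G (end₁ f) (end₂ f) →
    ∃ λ i → OccursOddly G T φ f i)
theorem1p5 t L ℓ with t ℕ.≤? 3
-- One colour fits the bound even for `L = 0`, and a constant colouring is defined without showing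
-- that no edge lies outside the forest.
... | yes t≤3 = 1 , ℕ.m≤n+m 1 (16 * L) , λ n G T no-minor forest → (λ _ → 0F) , λ f nonbridge →
  contradiction (K-minor-≤ t≤3 (nonbridge⇒triangle-minor G (SpanningForest.subgraph forest _ _ (adjacent f)) nonbridge)) no-minor
... | no t≰3 = 8 , 8≤ , λ n G T _ forest → colour forest ∘ index , occursOddly forest
  where
  1≤L : 1 ≤ L
  1≤L = Isℓ.bound ℓ 1 (2 , K 2 , K₂-no-minor (ℕ.∸-monoˡ-≤ 1 (ℕ.≰⇒> t≰3)) , K₂-starArboricity)
  8≤ : 8 ≤ 16 * L + 1
  8≤ = ℕ.≤-trans (ℕ.≤-trans (ℕ.m≤m+n 8 8) (ℕ.*-monoʳ-≤ 16 1≤L)) (ℕ.m≤m+n (16 * L) 1)
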